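{- Let $p$ and $q$ be two odd prime numbers with $p < q$. Then the Sombor index of the unit graph $G(\mathbb{Z}_{pq})$ is $$SO(G(\mathbb{Z}_{pq})) = \sqrt{2}\,\alpha\,\phi(pq) + \beta\sqrt{(\phi(pq))^2+(\phi(pq)-1)^2} + \sqrt{2}\,(|E|-\alpha-\beta)(\phi(pq)-1),$$ where $$\alpha = (p-1)(q-1), \qquad \beta = (p-1)(q-1)(p+q-3), \qquad |E| = \frac{(pq-1)\phi(pq)}{2}.$$
   Context: For a finite simple graph $G$, the Sombor index is $SO(G)=\sum_{uv\in E(G)}\sqrt{d_u^2+d_v^2}$, the sum being over (unordered) edges, where $d_x$ is the degree of the vertex $x$. For a commutative ring $R$ with unity, $U(R)$ denotes the set of units of $R$. The unit graph $G(R)$ is the simple graph whose vertices are all elements of $R$, with distinct vertices $x,y$ adjacent if and only if $x+y\in U(R)$. $\mathbb{Z}_n$ is the ring of integers modulo $n$ and $\phi$ is Euler's totient function. -}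

module Defs where

open import Algebra.Bundles using (CommutativeRing)
open import Algebra.Consequences.Propositional using (comm∧distrˡ⇒distrʳ)
open import Algebra.Definitions using (Invertible)
open import Data.Empty using (⊥-elim)
open import Data.Fin.Base using (Fin; toℕ)
import Data.Fin.Properties as Fin
open import Data.Integer.Base as ℤ using (ℤ; +_)
import Data.Integer.DivMod as ℤ
import Data.Integer.Properties as ℤ
import Data.Integer.Solver as ℤ
open import Data.List.Base using (List; length; filter; map; foldr; allFin; upTo; cartesianProduct)
open import Data.Nat.Base as ℕ using (ℕ; zero; suc; NonZero)
open import Data.Nat.Coprimality using (coprime?)
open import Data.Nat.DivMod using (_%_; _mod_; m<n⇒m%n≡m; m%n%n≡m%n; n%n≡0; %-distribˡ-+; %-distribˡ-*; m%n<n)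
open import Data.Nat.Primality using (Prime; prime⇒nonZero)
import Data.Nat.Properties as ℕ
open import Data.Product.Base using (_×_; _,_; ∃-syntax)
open import Data.Rational.Base as ℚ using (ℚ; 0ℚ; 1ℚ; ½; mkℚ; floor)
import Data.Rational.Properties as ℚ
open import Data.Rational.Solver using (module +-*-Solver)
import Data.Rational.Unnormalised.Base as ℚᵘ
import Data.Rational.Unnormalised.Properties as ℚᵘ
open import Data.Sum.Base using (inj₁; inj₂)
open import Function.Base using (_∘_)
open import Level using (Level; 0ℓ) renaming (suc to lsuc; _⊔_ to _⊔ˡ_)
open import Relation.Binary.Core using (Rel)
open import Relation.Binary.Definitions using (Decidable; Symmetric)
open import Relation.Binary.PropositionalEquality
open import Relation.Nullary.Decidable using (yes; no; ¬?; _×-dec_)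
open import Relation.Nullary.Negation using (¬_)

private
  variable
    a c ℓ : Level
    n : ℕ

module _ where
  open import Data.Rational.Base using (_+_; _*_; _-_; -_)
  open +-*-Solver

  +-interchange-- : ∀ a b c d → (a + b) - (c + d) ≡ (a - c) + (b - d)
  +-interchange-- = solve 4 (λ a b c d → (a :+ b) :- (c :+ d) := (a :- c) :+ (b :- d)) refl

  x≡[x-y]+y : ∀ a b → a ≡ (a - b) + b
  x≡[x-y]+y = solve 2 (λ a b → a := (a :- b) :+ b) refl

  x≡y+[x-y] : ∀ a b → a ≡ b + (a - b)
  x≡y+[x-y] = solve 2 (λ a b → a := b :+ (a :- b)) refl

  product-difference : ∀ a b c d → a * b - c * d ≡ a * (b - d) + d * (a - c)
  product-difference = solve 4 (λ a b c d → a :* b :- c :* d := a :* (b :- d) :+ d :* (a :- c)) refl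

  collect : ∀ a b e r → a * (e * r) + b * (e * r) ≡ e * ((a + b) * r)
  collect = solve 4 (λ a b e r → a :* (e :* r) :+ b :* (e :* r) := e :* ((a :+ b) :* r)) refl

  square-swap : ∀ r K → (r * r) * (K * K) ≡ (r * K) * (r * K)
  square-swap = solve 2 (λ r K → (r :* r) :* (K :* K) := (r :* K) :* (r :* K)) refl

  [s+u+η]-s : ∀ s u η → (s + u + η) - s ≡ u + η
  [s+u+η]-s = solve 3 (λ s u η → (s :+ u :+ η) :- s := u :+ η) refl

  square-+ : ∀ s η → s * s + η * η + (s * η + s * η) ≡ (s + η) * (s + η)
  square-+ = solve 2 (λ s η → s :* s :+ η :* η :+ (s :* η :+ s :* η) := (s :+ η) :* (s :+ η)) refl

  -‿-swap : ∀ y z → - (y - z) ≡ z - y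
  -‿-swap = solve 2 (λ y z → :- (y :- z) := z :- y) refl

-- Reals are Cauchy sequences of rationals, equal when their difference tends
-- to zero; _≃_ is the equality, and the arithmetic below is termwise.

Cauchy : (ℕ → ℚ) → Set
Cauchy x = ∀ ε → 0ℚ ℚ.< ε →
  ∃[ N ] (∀ i j → N ℕ.≤ i → N ℕ.≤ j → ℚ.∣ x i ℚ.- x j ∣ ℚ.< ε)

record ℝ : Set where
  constructor mkℝ
  field
    seq    : ℕ → ℚ
    cauchy : Cauchy seq

open ℝ public

infix 4 _≃_

record _≃_ (x y : ℝ) : Set where
  constructor mk≃
  field
    close : ∀ ε → 0ℚ ℚ.< ε →
      ∃[ N ] (∀ i → N ℕ.≤ i → ℚ.∣ seq x i ℚ.- seq y i ∣ ℚ.< ε)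

open _≃_ public

module _ where
  open import Data.Rational.Base hiding (NonZero; floor)
  open ℚ.≤-Reasoning

  ∣∣<-intro : ∀ {x ε} → x < ε → - x < ε → ∣ x ∣ < ε
  ∣∣<-intro {x} {ε} x<ε -x<ε with ℚ.∣p∣≡p∨∣p∣≡-p x
  ... | inj₁ eq = subst (_< ε) (sym eq) x<ε
  ... | inj₂ eq = subst (_< ε) (sym eq) -x<ε

  0<⇒0<½* : ∀ {ε} → 0ℚ < ε → 0ℚ < ½ * ε
  0<⇒0<½* {ε} 0<ε = subst (_< ½ * ε) (ℚ.*-zeroʳ ½) (ℚ.*-monoʳ-<-pos ½ 0<ε)

  ½*+½* : ∀ ε → ½ * ε + ½ * ε ≡ ε
  ½*+½* ε = trans (sym (ℚ.*-distribʳ-+ ε ½ ½)) (ℚ.*-identityˡ ε)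

  const-cauchy : ∀ q → Cauchy (λ _ → q)
  const-cauchy q ε 0<ε = 0 , λ _ _ _ _ →
    subst (λ t → ∣ t ∣ < ε) (sym (ℚ.+-inverseʳ q)) 0<ε

  +-cauchy : ∀ {x y} → Cauchy x → Cauchy y → Cauchy (λ i → x i + y i)
  +-cauchy {x} {y} cx cy ε 0<ε
    with M , p ← cx (½ * ε) (0<⇒0<½* 0<ε) | N , q ← cy (½ * ε) (0<⇒0<½* 0<ε)
    = M ℕ.⊔ N , λ i j ≤i ≤j → begin-strict
      ∣ (x i + y i) - (x j + y j) ∣    ≡⟨ cong ∣_∣ (+-interchange-- (x i) (y i) (x j) (y j)) ⟩
      ∣ (x i - x j) + (y i - y j) ∣    ≤⟨ ℚ.∣p+q∣≤∣p∣+∣q∣ (x i - x j) (y i - y j) ⟩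
      ∣ x i - x j ∣ + ∣ y i - y j ∣    <⟨ ℚ.+-mono-< (p i j (ℕ.m⊔n≤o⇒m≤o M N ≤i) (ℕ.m⊔n≤o⇒m≤o M N ≤j))
                                                    (q i j (ℕ.m⊔n≤o⇒n≤o M N ≤i) (ℕ.m⊔n≤o⇒n≤o M N ≤j)) ⟩
      ½ * ε + ½ * ε                    ≡⟨ ½*+½* ε ⟩
      ε                                ∎

  neg-cauchy : ∀ {x} → Cauchy x → Cauchy (λ i → - x i)
  neg-cauchy {x} cx ε 0<ε with N , p ← cx ε 0<ε = N , λ i j ≤i ≤j → begin-strict
    ∣ - x i - - x j ∣      ≡⟨ cong ∣_∣ (sym (ℚ.neg-distrib-+ (x i) (- x j))) ⟩
    ∣ - (x i - x j) ∣      ≡⟨ ℚ.∣-p∣≡∣p∣ (x i - x j) ⟩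
    ∣ x i - x j ∣          <⟨ p i j ≤i ≤j ⟩
    ε                      ∎

  cauchy-bound : ∀ {x} → Cauchy x →
    ∃[ B ] 0ℚ < B × ∃[ N ] (∀ i → N ℕ.≤ i → ∣ x i ∣ ≤ B)
  cauchy-bound {x} cx with N , p ← cx 1ℚ (ℚ.positive⁻¹ 1ℚ) =
    1ℚ + ∣ x N ∣ ,
    subst (_< 1ℚ + ∣ x N ∣) (ℚ.+-identityʳ 0ℚ) (ℚ.+-mono-<-≤ (ℚ.positive⁻¹ 1ℚ) (ℚ.0≤∣p∣ (x N))) ,
    N , λ i ≤i → begin
      ∣ x i ∣                      ≡⟨ cong ∣_∣ (x≡[x-y]+y (x i) (x N)) ⟩
      ∣ (x i - x N) + x N ∣        ≤⟨ ℚ.∣p+q∣≤∣p∣+∣q∣ (x i - x N) (x N) ⟩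
      ∣ x i - x N ∣ + ∣ x N ∣      ≤⟨ ℚ.+-monoˡ-≤ ∣ x N ∣ (ℚ.<⇒≤ (p i N ≤i ℕ.≤-refl)) ⟩
      1ℚ + ∣ x N ∣                 ∎

  split-product : ∀ A B ε → 0ℚ < A → 0ℚ < B → 0ℚ < ε →
                  ∃[ δ ] 0ℚ < δ × A * δ + B * δ ≡ ε
  split-product A B ε 0<A 0<B 0<ε = go (A + B) refl (ℚ.+-mono-< 0<A 0<B)
    where
    go : ∀ C → A + B ≡ C → 0ℚ < C → ∃[ δ ] 0ℚ < δ × A * δ + B * δ ≡ ε
    go C A+B≡C 0<C = ε * r , ℚ.positive⁻¹ (ε * r) {{ℚ.pos*pos⇒pos ε {{positive 0<ε}} r {{r⁺}}}} , (begin-equality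
      A * (ε * r) + B * (ε * r)   ≡⟨ collect A B ε r ⟩
      ε * ((A + B) * r)           ≡⟨ cong (λ t → ε * (t * r)) A+B≡C ⟩
      ε * (C * r)                 ≡⟨ cong (ε *_) (ℚ.*-inverseʳ C {{C≢0}}) ⟩
      ε * 1ℚ                      ≡⟨ ℚ.*-identityʳ ε ⟩
      ε                           ∎)
      where
      C≢0 : ℚ.NonZero C
      C≢0 = ℚ.pos⇒nonZero C {{positive 0<C}}
      r : ℚ
      r = (1/ C) {{C≢0}}
      r⁺ : Positive r
      r⁺ = ℚ.1/pos⇒pos C {{positive 0<C}}

  product-close : ∀ {A B δ ε a b c d} → 0ℚ < A → 0ℚ < B → A * δ + B * δ ≡ ε →
                  ∣ a ∣ ≤ A → ∣ d ∣ ≤ B → ∣ a - c ∣ < δ → ∣ b - d ∣ < δ →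
                  ∣ a * b - c * d ∣ < ε
  product-close {A} {B} {δ} {ε} {a} {b} {c} {d} 0<A 0<B Aδ+Bδ≡ε ∣a∣≤A ∣d∣≤B a~c b~d = begin-strict
    ∣ a * b - c * d ∣
      ≡⟨ cong ∣_∣ (product-difference a b c d) ⟩
    ∣ a * (b - d) + d * (a - c) ∣
      ≤⟨ ℚ.∣p+q∣≤∣p∣+∣q∣ (a * (b - d)) (d * (a - c)) ⟩
    ∣ a * (b - d) ∣ + ∣ d * (a - c) ∣
      ≡⟨ cong₂ _+_ (ℚ.∣p*q∣≡∣p∣*∣q∣ a (b - d)) (ℚ.∣p*q∣≡∣p∣*∣q∣ d (a - c)) ⟩
    ∣ a ∣ * ∣ b - d ∣ + ∣ d ∣ * ∣ a - c ∣
      ≤⟨ ℚ.+-mono-≤ (ℚ.*-monoʳ-≤-nonNeg ∣ b - d ∣ {{ℚ.∣-∣-nonNeg (b - d)}} ∣a∣≤A)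
                    (ℚ.*-monoʳ-≤-nonNeg ∣ a - c ∣ {{ℚ.∣-∣-nonNeg (a - c)}} ∣d∣≤B) ⟩
    A * ∣ b - d ∣ + B * ∣ a - c ∣
      <⟨ ℚ.+-mono-< (ℚ.*-monoʳ-<-pos A {{positive 0<A}} b~d) (ℚ.*-monoʳ-<-pos B {{positive 0<B}} a~c) ⟩
    A * δ + B * δ
      ≡⟨ Aδ+Bδ≡ε ⟩
    ε ∎

  *-cauchy : ∀ {x y} → Cauchy x → Cauchy y → Cauchy (λ i → x i * y i)
  *-cauchy {x} {y} cx cy ε 0<ε = go (cauchy-bound {x} cx) (cauchy-bound {y} cy)
    where
    Bounded : (ℕ → ℚ) → Set
    Bounded z = ∃[ B ] 0ℚ < B × ∃[ N ] (∀ i → N ℕ.≤ i → ∣ z i ∣ ≤ B)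
    Close : (ℕ → ℚ) → ℚ → Set
    Close z δ = ∃[ N ] (∀ i j → N ℕ.≤ i → N ℕ.≤ j → ∣ z i - z j ∣ < δ)
    go : Bounded x → Bounded y → Close (λ i → x i * y i) ε
    go (A , 0<A , K , bx) (B , 0<B , L , by) = go′ (split-product A B ε 0<A 0<B 0<ε)
      where
      go″ : ∀ δ → A * δ + B * δ ≡ ε → Close x δ → Close y δ → Close (λ i → x i * y i) ε
      go″ δ eq (M , p) (N , q) = (K ℕ.⊔ L) ℕ.⊔ (M ℕ.⊔ N) , λ i j ≤i ≤j →
        let K⊔L≤i = ℕ.m⊔n≤o⇒m≤o (K ℕ.⊔ L) (M ℕ.⊔ N) ≤i
            K⊔L≤j = ℕ.m⊔n≤o⇒m≤o (K ℕ.⊔ L) (M ℕ.⊔ N) ≤j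
            M⊔N≤i = ℕ.m⊔n≤o⇒n≤o (K ℕ.⊔ L) (M ℕ.⊔ N) ≤i
            M⊔N≤j = ℕ.m⊔n≤o⇒n≤o (K ℕ.⊔ L) (M ℕ.⊔ N) ≤j
        in product-close {A} {B} {δ} {ε} {x i} {y i} {x j} {y j} 0<A 0<B eq
             (bx i (ℕ.m⊔n≤o⇒m≤o K L K⊔L≤i)) (by j (ℕ.m⊔n≤o⇒n≤o K L K⊔L≤j))
             (p i j (ℕ.m⊔n≤o⇒m≤o M N M⊔N≤i) (ℕ.m⊔n≤o⇒m≤o M N M⊔N≤j))
             (q i j (ℕ.m⊔n≤o⇒n≤o M N M⊔N≤i) (ℕ.m⊔n≤o⇒n≤o M N M⊔N≤j))
      go′ : ∃[ δ ] 0ℚ < δ × A * δ + B * δ ≡ ε → Close (λ i → x i * y i) ε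
      go′ (δ , 0<δ , eq) = go″ δ eq (cx δ 0<δ) (cy δ 0<δ)

isqrt-step : ℕ → ℕ → ℕ
isqrt-step n r with suc r ℕ.* suc r ℕ.≤? n
... | yes _ = suc r
... | no  _ = r

isqrt : ℕ → ℕ
isqrt zero    = zero
isqrt (suc n) = isqrt-step (suc n) (isqrt n)

isqrt-step-lower : ∀ n r → r ℕ.* r ℕ.≤ n → isqrt-step (suc n) r ℕ.* isqrt-step (suc n) r ℕ.≤ suc n
isqrt-step-lower n r r²≤n with suc r ℕ.* suc r ℕ.≤? suc n
... | yes s²≤ = s²≤
... | no  _   = ℕ.m≤n⇒m≤1+n r²≤n

isqrt-step-upper : ∀ n r → n ℕ.< suc r ℕ.* suc r →
                   suc n ℕ.< suc (isqrt-step (suc n) r) ℕ.* suc (isqrt-step (suc n) r)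
isqrt-step-upper n r n<s² with suc r ℕ.* suc r ℕ.≤? suc n
... | yes _   = ℕ.≤-<-trans n<s²
  (ℕ.*-mono-< {suc r} {suc (suc r)} {suc r} {suc (suc r)} (ℕ.n<1+n _) (ℕ.n<1+n _))
... | no  s²≰ = ℕ.≰⇒> s²≰

isqrt-lower : ∀ n → isqrt n ℕ.* isqrt n ℕ.≤ n
isqrt-lower zero    = ℕ.z≤n
isqrt-lower (suc n) = isqrt-step-lower n (isqrt n) (isqrt-lower n)

isqrt-upper : ∀ n → n ℕ.< suc (isqrt n) ℕ.* suc (isqrt n)
isqrt-upper zero    = ℕ.s≤s ℕ.z≤n
isqrt-upper (suc n) = isqrt-step-upper n (isqrt n) (isqrt-upper n)

module _ where
  open import Data.Rational.Base hiding (NonZero; floor)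
  open ℚ.≤-Reasoning

  √≈-numerator : ℚ → ℕ → ℕ
  √≈-numerator a k = isqrt ℤ.∣ floor ((0ℚ ⊔ a) * (K * K)) ∣
    where K = + suc k / 1

  -- The largest nonnegative multiple of 1/(k+1) whose square is at most max(0,a).
  √≈ : ℚ → ℕ → ℚ
  √≈ a k = + √≈-numerator a k / suc k

  ι : ℤ → ℚ
  ι z = z / 1

  ι-mono-≤ : ∀ {y z} → y ℤ.≤ z → ι y ≤ ι z
  ι-mono-≤ {y} {z} y≤z = ℚ.toℚᵘ-cancel-≤
    (ℚᵘ.≤-respˡ-≃ (ℚᵘ.≃-sym (ℚ.toℚᵘ-fromℚᵘ (ℚᵘ.mkℚᵘ y 0)))
    (ℚᵘ.≤-respʳ-≃ (ℚᵘ.≃-sym (ℚ.toℚᵘ-fromℚᵘ (ℚᵘ.mkℚᵘ z 0)))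
    (ℚᵘ.*≤* (ℤ.*-monoʳ-≤-nonNeg (+ 1) y≤z))))

  ι-* : ∀ m n → ι (+ (m ℕ.* n)) ≡ ι (+ m) * ι (+ n)
  ι-* m n = ℚ.toℚᵘ-injective
    (ℚᵘ.≃-trans (ℚ.toℚᵘ-fromℚᵘ (ℚᵘ.mkℚᵘ (+ (m ℕ.* n)) 0))
    (ℚᵘ.≃-sym (ℚᵘ.≃-trans (ℚ.toℚᵘ-homo-* (ι (+ m)) (ι (+ n)))
      (ℚᵘ.≃-trans (ℚᵘ.*-cong (ℚ.toℚᵘ-fromℚᵘ (ℚᵘ.mkℚᵘ (+ m) 0)) (ℚ.toℚᵘ-fromℚᵘ (ℚᵘ.mkℚᵘ (+ n) 0)))
        (ℚᵘ.*≡* (cong (ℤ._* + 1) (sym (ℤ.pos-* m n))))))))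

  /-*-cancel : ∀ j k → (+ j / suc k) * ι (+ suc k) ≡ ι (+ j)
  /-*-cancel j k = ℚ.toℚᵘ-injective
    (ℚᵘ.≃-trans (ℚ.toℚᵘ-homo-* (+ j / suc k) (ι (+ suc k)))
    (ℚᵘ.≃-trans (ℚᵘ.*-cong (ℚ.toℚᵘ-fromℚᵘ (ℚᵘ.mkℚᵘ (+ j) k)) (ℚ.toℚᵘ-fromℚᵘ (ℚᵘ.mkℚᵘ (+ suc k) 0)))
    (ℚᵘ.≃-trans (ℚᵘ.*≡* (trans (ℤ.*-assoc (+ j) (+ suc k) (+ 1))
                          (cong (+ j ℤ.*_) (trans (ℤ.*-comm (+ suc k) (+ 1))
                            (trans (ℤ.*-identityˡ (+ suc k)) (cong (λ t → + suc t) (sym (ℕ.*-identityʳ k))))))))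
      (ℚᵘ.≃-sym (ℚ.toℚᵘ-fromℚᵘ (ℚᵘ.mkℚᵘ (+ j) 0))))))

  floor-lower : ∀ q → ι (floor q) ≤ q
  floor-lower q@(mkℚ z d _) = ℚ.toℚᵘ-cancel-≤
    (ℚᵘ.≤-respˡ-≃ (ℚᵘ.≃-sym (ℚ.toℚᵘ-fromℚᵘ (ℚᵘ.mkℚᵘ (floor q) 0)))
    (ℚᵘ.*≤* (subst (floor q ℤ.* + suc d ℤ.≤_) (sym (ℤ.*-identityʳ z)) (ℤ.[n/d]*d≤n z (+ suc d)))))

  floor-upper : ∀ q → q < ι (ℤ.suc (floor q))
  floor-upper q@(mkℚ z d _) = ℚ.toℚᵘ-cancel-<
    (ℚᵘ.<-respʳ-≃ (ℚᵘ.≃-sym (ℚ.toℚᵘ-fromℚᵘ (ℚᵘ.mkℚᵘ (ℤ.suc (floor q)) 0)))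
    (ℚᵘ.*<* (subst₂ ℤ._<_ (sym (ℤ.*-identityʳ z))
      (cong (λ t → ℤ.suc t ℤ.* + suc d) (sym (ℤ.div-pos-is-/ℕ z (suc d))))
      (ℤ.n<s[n/ℕd]*d z (suc d)))))

  floor-nonneg : ∀ q → 0ℚ ≤ q → + ℤ.∣ floor q ∣ ≡ floor q
  floor-nonneg q@(mkℚ z d _) 0≤q = ℤ.0≤i⇒+∣i∣≡i
    (ℤ.0≤n⇒0≤n/d z (+ suc d) (ℤ.nonNegative⁻¹ z {{nonNegative 0≤q}}) (ℤ.+≤+ ℕ.z≤n))

  module _ (a : ℚ) (k : ℕ) where
    private
      K b : ℚ
      K = ι (+ suc k)
      b = (0ℚ ⊔ a) * (K * K)
      m j : ℕ
      m = ℤ.∣ floor b ∣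
      j = √≈-numerator a k
      instance
        K⁺ : Positive K
        K⁺ = ℚ.normalize-pos (suc k) 1
        KK⁺ : Positive (K * K)
        KK⁺ = ℚ.pos*pos⇒pos K K
        KK≥0 : NonNegative (K * K)
        KK≥0 = ℚ.pos⇒nonNeg (K * K)
      0≤b : 0ℚ ≤ b
      0≤b = subst (_≤ b) (ℚ.*-zeroˡ (K * K)) (ℚ.*-monoʳ-≤-nonNeg (K * K) (ℚ.p≤p⊔q 0ℚ a))
      +m≡ : + m ≡ floor b
      +m≡ = floor-nonneg b 0≤b
      grid : ∀ i → ((+ i / suc k) * (+ i / suc k)) * (K * K) ≡ ι (+ (i ℕ.* i))
      grid i = trans (square-swap (+ i / suc k) K)
        (trans (cong₂ _*_ (/-*-cancel i k) (/-*-cancel i k)) (sym (ι-* i i)))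

    √≈-lower : √≈ a k * √≈ a k ≤ 0ℚ ⊔ a
    √≈-lower = ℚ.*-cancelʳ-≤-pos (K * K) (begin
      (√≈ a k * √≈ a k) * (K * K)  ≡⟨ grid j ⟩
      ι (+ (j ℕ.* j))              ≤⟨ ι-mono-≤ (ℤ.+≤+ (isqrt-lower m)) ⟩
      ι (+ m)                      ≡⟨ cong ι +m≡ ⟩
      ι (floor b)                  ≤⟨ floor-lower b ⟩
      b                            ∎)

    √≈-upper : 0ℚ ⊔ a < (+ suc j / suc k) * (+ suc j / suc k)
    √≈-upper = ℚ.*-cancelʳ-<-nonNeg (K * K) (begin-strict
      b                                                  <⟨ floor-upper b ⟩
      ι (ℤ.suc (floor b))                                ≡⟨ cong (ι ∘ ℤ.suc) (sym +m≡) ⟩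
      ι (+ suc m)                                        ≤⟨ ι-mono-≤ (ℤ.+≤+ (isqrt-upper m)) ⟩
      ι (+ (suc j ℕ.* suc j))                            ≡⟨ sym (grid (suc j)) ⟩
      ((+ suc j / suc k) * (+ suc j / suc k)) * (K * K)  ∎)

  /-suc : ∀ j k → (+ j / suc k) + (+ 1 / suc k) ≡ + suc j / suc k
  /-suc j k = ℚ.toℚᵘ-injective
    (ℚᵘ.≃-trans (ℚ.toℚᵘ-homo-+ (+ j / suc k) (+ 1 / suc k))
    (ℚᵘ.≃-trans (ℚᵘ.+-cong (ℚ.toℚᵘ-fromℚᵘ (ℚᵘ.mkℚᵘ (+ j) k)) (ℚ.toℚᵘ-fromℚᵘ (ℚᵘ.mkℚᵘ (+ 1) k)))
    (ℚᵘ.≃-trans (ℚᵘ.*≡* (step (+ j) (+ suc k)))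
      (ℚᵘ.≃-sym (ℚ.toℚᵘ-fromℚᵘ (ℚᵘ.mkℚᵘ (+ suc j) k))))))
    where
    open ℤ.+-*-Solver
    step : ∀ j k → (j ℤ.* k ℤ.+ + 1 ℤ.* k) ℤ.* k ≡ (+ 1 ℤ.+ j) ℤ.* (k ℤ.* k)
    step = solve 2 (λ j k → (j :* k :+ con (+ 1) :* k) :* k := (con (+ 1) :+ j) :* (k :* k)) refl

  archimedean : ∀ ε → 0ℚ < ε → ∃[ N ] (∀ k → N ℕ.≤ k → + 1 / suc k < ε)
  archimedean ε@(mkℚ z d _) 0<ε = aux z refl
    where
    aux : ∀ y → z ≡ y → ∃[ N ] (∀ k → N ℕ.≤ k → + 1 / suc k < ε)
    aux (+ suc n) refl = suc d , λ k d<k → ℚ.toℚᵘ-cancel-<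
      (ℚᵘ.<-respˡ-≃ (ℚᵘ.≃-sym (ℚ.toℚᵘ-fromℚᵘ (ℚᵘ.mkℚᵘ (+ 1) k)))
      (ℚᵘ.*<* (subst₂ ℤ._<_ (sym (ℤ.*-identityˡ (+ suc d))) (ℤ.pos-* (suc n) (suc k))
        (ℤ.+<+ (ℕ.≤-trans (ℕ.s≤s d<k) (ℕ.m≤m+n (suc k) (n ℕ.* suc k)))))))
    aux (+ zero) refl with () ← positive 0<ε
    aux (ℤ.-[1+ n ]) refl with () ← positive 0<ε

  <+-from-squares : ∀ r s η a b → 0ℚ ≤ r → 0ℚ ≤ s → 0ℚ < η →
                    r * r ≤ a → a ≤ b + η * η → b < s * s → r < s + η
  <+-from-squares r s η a b 0≤r 0≤s 0<η r²≤a a≤b+η² b<s² = ℚ.≰⇒> λ s+η≤r →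
    ℚ.<-irrefl {a} refl (begin-strict
      a                                ≤⟨ a≤b+η² ⟩
      b + η * η                        <⟨ ℚ.+-monoˡ-< (η * η) b<s² ⟩
      s * s + η * η                    ≡⟨ sym (ℚ.+-identityʳ _) ⟩
      s * s + η * η + 0ℚ               ≤⟨ ℚ.+-monoʳ-≤ (s * s + η * η) (ℚ.nonNegative⁻¹ (s * η + s * η) {{2sη≥0}}) ⟩
      s * s + η * η + (s * η + s * η)  ≡⟨ square-+ s η ⟩
      (s + η) * (s + η)                ≤⟨ ℚ.*-monoʳ-≤-nonNeg (s + η) {{s+η≥0}} s+η≤r ⟩
      r * (s + η)                      ≤⟨ ℚ.*-monoˡ-≤-nonNeg r {{nonNegative 0≤r}} s+η≤r ⟩
      r * r                            ≤⟨ r²≤a ⟩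
      a                                ∎)
    where
    s≥0 : NonNegative s
    s≥0 = nonNegative 0≤s
    η≥0 : NonNegative η
    η≥0 = nonNegative (ℚ.<⇒≤ 0<η)
    s+η≥0 : NonNegative (s + η)
    s+η≥0 = ℚ.nonNeg+nonNeg⇒nonNeg s {{s≥0}} η {{η≥0}}
    sη≥0 : NonNegative (s * η)
    sη≥0 = ℚ.nonNeg*nonNeg⇒nonNeg s {{s≥0}} η {{η≥0}}
    2sη≥0 : NonNegative (s * η + s * η)
    2sη≥0 = ℚ.nonNeg+nonNeg⇒nonNeg (s * η) {{sη≥0}} (s * η) {{sη≥0}}

  positive-part-close : ∀ a b δ → 0ℚ ≤ δ → a - b < δ → 0ℚ ⊔ a ≤ (0ℚ ⊔ b) + δ
  positive-part-close a b δ 0≤δ a-b<δ = ℚ.⊔-lub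
    (begin
      0ℚ              ≡⟨ sym (ℚ.+-identityʳ 0ℚ) ⟩
      0ℚ + 0ℚ         ≤⟨ ℚ.+-mono-≤ (ℚ.p≤p⊔q 0ℚ b) 0≤δ ⟩
      (0ℚ ⊔ b) + δ    ∎)
    (begin
      a               ≡⟨ x≡y+[x-y] a b ⟩
      b + (a - b)     ≤⟨ ℚ.+-mono-≤ (ℚ.p≤q⊔p 0ℚ b) (ℚ.<⇒≤ a-b<δ) ⟩
      (0ℚ ⊔ b) + δ    ∎)

  <⇒-< : ∀ r t u η → r < (t + u) + η → r - t < u + η
  <⇒-< r t u η r< = begin-strict
    r - t              <⟨ ℚ.+-monoˡ-< (- t) r< ⟩
    (t + u + η) - t    ≡⟨ [s+u+η]-s t u η ⟩
    u + η              ∎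

  0≤/ : ∀ j k → 0ℚ ≤ + j / suc k
  0≤/ j k = ℚ.nonNegative⁻¹ (+ j / suc k) {{ℚ.normalize-nonNeg j (suc k)}}

  √≈-close : ∀ a b η → 0ℚ < η → a - b < η * η → ∀ k l →
             √≈ a k - √≈ b l < (+ 1 / suc l) + η
  √≈-close a b η 0<η a-b<η² k l = <⇒-< (√≈ a k) (√≈ b l) (+ 1 / suc l) η
    (subst (λ t → √≈ a k < t + η) (sym (/-suc j l))
      (<+-from-squares (√≈ a k) (+ suc j / suc l) η (0ℚ ⊔ a) (0ℚ ⊔ b)
        (0≤/ (√≈-numerator a k) k) (0≤/ (suc j) l) 0<η (√≈-lower a k)
        (positive-part-close a b (η * η) 0≤η² a-b<η²) (√≈-upper b l)))
    where
    j : ℕ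
    j = √≈-numerator b l
    0≤η² : 0ℚ ≤ η * η
    0≤η² = ℚ.<⇒≤ (ℚ.positive⁻¹ (η * η) {{ℚ.pos*pos⇒pos η {{positive 0<η}} η {{positive 0<η}}}})

  √-cauchy : ∀ {x} → Cauchy x → Cauchy (λ i → √≈ (x i) i)
  √-cauchy {x} cx ε 0<ε = go (cx (η * η) 0<η²) (archimedean η 0<η)
    where
    η = ½ * ε
    0<η : 0ℚ < η
    0<η = 0<⇒0<½* 0<ε
    0<η² : 0ℚ < η * η
    0<η² = ℚ.positive⁻¹ (η * η) {{ℚ.pos*pos⇒pos η {{positive 0<η}} η {{positive 0<η}}}}
    p≤∣p∣ : ∀ t → t ≤ ∣ t ∣
    p≤∣p∣ t with ℚ.≤-total 0ℚ t
    ... | inj₁ 0≤t = ℚ.≤-reflexive (sym (ℚ.0≤p⇒∣p∣≡p 0≤t))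
    ... | inj₂ t≤0 = ℚ.≤-trans t≤0 (ℚ.0≤∣p∣ t)
    go : ∃[ M ] (∀ i j → M ℕ.≤ i → M ℕ.≤ j → ∣ x i - x j ∣ < η * η) →
         ∃[ N ] (∀ k → N ℕ.≤ k → + 1 / suc k < η) →
         ∃[ N ] (∀ i j → N ℕ.≤ i → N ℕ.≤ j → ∣ √≈ (x i) i - √≈ (x j) j ∣ < ε)
    go (M , p) (N , q) = M ℕ.⊔ N , λ i j ≤i ≤j → ∣∣<-intro
        (half i j ≤i ≤j)
        (subst (_< ε) (sym (-‿-swap (√≈ (x i) i) (√≈ (x j) j))) (half j i ≤j ≤i))
      where
      half : ∀ i j → M ℕ.⊔ N ℕ.≤ i → M ℕ.⊔ N ℕ.≤ j → √≈ (x i) i - √≈ (x j) j < ε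
      half i j ≤i ≤j = begin-strict
        √≈ (x i) i - √≈ (x j) j   <⟨ √≈-close (x i) (x j) η 0<η (ℚ.≤-<-trans (p≤∣p∣ (x i - x j)) (p i j (ℕ.m⊔n≤o⇒m≤o M N ≤i) (ℕ.m⊔n≤o⇒m≤o M N ≤j))) i j ⟩
        (+ 1 / suc j) + η         <⟨ ℚ.+-monoˡ-< η (q j (ℕ.m⊔n≤o⇒n≤o M N ≤j)) ⟩
        η + η                     ≡⟨ ½*+½* ε ⟩
        ε                         ∎

infix  9 _²ᴿ
infix  8 -ᴿ_
infixl 7 _*ᴿ_
infixl 6 _+ᴿ_ _-ᴿ_

fromℚ : ℚ → ℝ
fromℚ q = mkℝ (λ _ → q) (const-cauchy q)

fromℕ : ℕ → ℝ
fromℕ n = fromℚ (+ n ℚ./ 1)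

-ᴿ_ : ℝ → ℝ
-ᴿ x = mkℝ (λ i → ℚ.- seq x i) (neg-cauchy {seq x} (cauchy x))

_+ᴿ_ _*ᴿ_ _-ᴿ_ : ℝ → ℝ → ℝ
x +ᴿ y = mkℝ (λ i → seq x i ℚ.+ seq y i) (+-cauchy {seq x} {seq y} (cauchy x) (cauchy y))
x *ᴿ y = mkℝ (λ i → seq x i ℚ.* seq y i) (*-cauchy {seq x} {seq y} (cauchy x) (cauchy y))

x -ᴿ y = x +ᴿ -ᴿ y

-- On negative reals √ takes the value 0.
√ : ℝ → ℝ
√ x = mkℝ (λ i → √≈ (seq x i) i) (√-cauchy {seq x} (cauchy x))

_²ᴿ : ℝ → ℝ
x ²ᴿ = x *ᴿ x

sumᴿ : List ℝ → ℝ
sumᴿ = foldr _+ᴿ_ (fromℕ 0)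

record SimpleGraph (V : Set a) ℓ : Set (a ⊔ˡ lsuc ℓ) where
  field
    Adj         : Rel V ℓ
    symmetric   : Symmetric Adj
    irreflexive : ∀ {v} → ¬ Adj v v

open SimpleGraph public

-- The decision procedure only makes counting possible; none of the quantities
-- below depends on which one is supplied.
module _ (G : SimpleGraph (Fin n) ℓ) (adj? : Decidable (Adj G)) where

  degree : Fin n → ℕ
  degree v = length (filter (adj? v) (allFin n))

  -- Each unordered edge is listed once, with its smaller endpoint first.
  edges : List (Fin n × Fin n)
  edges = filter (λ (u , v) → (u Fin.<? v) ×-dec adj? u v)
                 (cartesianProduct (allFin n) (allFin n))

  somborIndex : ℝ
  somborIndex = sumᴿ (map (λ (u , v) → √ (fromℕ (degree u) ²ᴿ +ᴿ fromℕ (degree v) ²ᴿ)) edges)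

module _ (R : CommutativeRing c ℓ) where
  open CommutativeRing R

  IsUnit : Carrier → Set (c ⊔ˡ ℓ)
  IsUnit = Invertible _≈_ 1# _*_

  unitGraph : SimpleGraph Carrier (c ⊔ˡ ℓ)
  unitGraph = record
    { Adj         = λ x y → ¬ (x ≈ y) × IsUnit (x + y)
    ; symmetric   = λ {x} {y} (x≉y , z , zx , xz) →
        (λ y≈x → x≉y (CommutativeRing.sym R y≈x)) , z ,
        CommutativeRing.trans R (*-congˡ (+-comm y x)) zx ,
        CommutativeRing.trans R (*-congʳ (+-comm y x)) xz
    ; irreflexive = λ (x≉x , _) → x≉x (CommutativeRing.refl R)
    }

module Mod (n : ℕ) .{{_ : NonZero n}} where

  infixl 6 _+ₙ_
  infixl 7 _*ₙ_

  _+ₙ_ _*ₙ_ : Fin n → Fin n → Fin n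
  i +ₙ j = (toℕ i ℕ.+ toℕ j) mod n
  i *ₙ j = (toℕ i ℕ.* toℕ j) mod n

  -ₙ_ : Fin n → Fin n
  -ₙ i = (n ℕ.∸ toℕ i) mod n

  0ₙ 1ₙ : Fin n
  0ₙ = 0 mod n
  1ₙ = 1 mod n

  toℕ-mod : ∀ m → toℕ (m mod n) ≡ m % n
  toℕ-mod m = Fin.toℕ-fromℕ< (m%n<n m n)

  mod-cong : ∀ {k m} → k % n ≡ m % n → k mod n ≡ m mod n
  mod-cong {k} {m} eq = Fin.toℕ-injective (trans (toℕ-mod k) (trans eq (sym (toℕ-mod m))))

  toℕ-mod-id : ∀ i → toℕ i mod n ≡ i
  toℕ-mod-id i = Fin.toℕ-injective (trans (toℕ-mod (toℕ i)) (m<n⇒m%n≡m (Fin.toℕ<n i)))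

  +-modˡ : ∀ k m → (toℕ (k mod n) ℕ.+ m) mod n ≡ (k ℕ.+ m) mod n
  +-modˡ k m = mod-cong (begin
    (toℕ (k mod n) ℕ.+ m) % n          ≡⟨ cong (λ t → (t ℕ.+ m) % n) (toℕ-mod k) ⟩
    (k % n ℕ.+ m) % n                  ≡⟨ %-distribˡ-+ (k % n) m n ⟩
    (k % n % n ℕ.+ m % n) % n          ≡⟨ cong (λ t → (t ℕ.+ m % n) % n) (m%n%n≡m%n k n) ⟩
    (k % n ℕ.+ m % n) % n              ≡⟨ sym (%-distribˡ-+ k m n) ⟩
    (k ℕ.+ m) % n                      ∎)
    where open ≡-Reasoning

  *-modˡ : ∀ k m → (toℕ (k mod n) ℕ.* m) mod n ≡ (k ℕ.* m) mod n
  *-modˡ k m = mod-cong (begin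
    (toℕ (k mod n) ℕ.* m) % n          ≡⟨ cong (λ t → (t ℕ.* m) % n) (toℕ-mod k) ⟩
    (k % n ℕ.* m) % n                  ≡⟨ %-distribˡ-* (k % n) m n ⟩
    (k % n % n ℕ.* (m % n)) % n        ≡⟨ cong (λ t → (t ℕ.* (m % n)) % n) (m%n%n≡m%n k n) ⟩
    (k % n ℕ.* (m % n)) % n            ≡⟨ sym (%-distribˡ-* k m n) ⟩
    (k ℕ.* m) % n                      ∎)
    where open ≡-Reasoning

  +ₙ-comm : ∀ i j → i +ₙ j ≡ j +ₙ i
  +ₙ-comm i j = cong (_mod n) (ℕ.+-comm (toℕ i) (toℕ j))

  *ₙ-comm : ∀ i j → i *ₙ j ≡ j *ₙ i
  *ₙ-comm i j = cong (_mod n) (ℕ.*-comm (toℕ i) (toℕ j))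

  +-modʳ : ∀ k m → (k ℕ.+ toℕ (m mod n)) mod n ≡ (k ℕ.+ m) mod n
  +-modʳ k m = trans (cong (_mod n) (ℕ.+-comm k _))
    (trans (+-modˡ m k) (cong (_mod n) (ℕ.+-comm m k)))

  *-modʳ : ∀ k m → (k ℕ.* toℕ (m mod n)) mod n ≡ (k ℕ.* m) mod n
  *-modʳ k m = trans (cong (_mod n) (ℕ.*-comm k _))
    (trans (*-modˡ m k) (cong (_mod n) (ℕ.*-comm m k)))

  +ₙ-assoc : ∀ i j k → (i +ₙ j) +ₙ k ≡ i +ₙ (j +ₙ k)
  +ₙ-assoc i j k = trans (+-modˡ (toℕ i ℕ.+ toℕ j) (toℕ k))
    (trans (cong (_mod n) (ℕ.+-assoc (toℕ i) (toℕ j) (toℕ k)))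
           (sym (+-modʳ (toℕ i) (toℕ j ℕ.+ toℕ k))))

  *ₙ-assoc : ∀ i j k → (i *ₙ j) *ₙ k ≡ i *ₙ (j *ₙ k)
  *ₙ-assoc i j k = trans (*-modˡ (toℕ i ℕ.* toℕ j) (toℕ k))
    (trans (cong (_mod n) (ℕ.*-assoc (toℕ i) (toℕ j) (toℕ k)))
           (sym (*-modʳ (toℕ i) (toℕ j ℕ.* toℕ k))))

  +ₙ-identityˡ : ∀ i → 0ₙ +ₙ i ≡ i
  +ₙ-identityˡ i = trans (+-modˡ 0 (toℕ i)) (toℕ-mod-id i)

  *ₙ-identityˡ : ∀ i → 1ₙ *ₙ i ≡ i
  *ₙ-identityˡ i = trans (*-modˡ 1 (toℕ i))
    (trans (cong (_mod n) (ℕ.*-identityˡ (toℕ i))) (toℕ-mod-id i))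

  +ₙ-inverseʳ : ∀ i → i +ₙ (-ₙ i) ≡ 0ₙ
  +ₙ-inverseʳ i = trans (+-modʳ (toℕ i) (n ℕ.∸ toℕ i))
    (trans (cong (_mod n) (ℕ.m+[n∸m]≡n (ℕ.<⇒≤ (Fin.toℕ<n i))))
           (mod-cong (trans (n%n≡0 n) (sym (m<n⇒m%n≡m (ℕ.>-nonZero⁻¹ n))))))

  *ₙ-distribˡ-+ₙ : ∀ i j k → i *ₙ (j +ₙ k) ≡ (i *ₙ j) +ₙ (i *ₙ k)
  *ₙ-distribˡ-+ₙ i j k = trans (*-modʳ (toℕ i) (toℕ j ℕ.+ toℕ k))
    (trans (cong (_mod n) (ℕ.*-distribˡ-+ (toℕ i) (toℕ j) (toℕ k)))
    (sym (trans (+-modˡ (toℕ i ℕ.* toℕ j) _) (+-modʳ (toℕ i ℕ.* toℕ j) (toℕ i ℕ.* toℕ k)))))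

ℤ/ : (n : ℕ) .{{_ : NonZero n}} → CommutativeRing 0ℓ 0ℓ
ℤ/ n = record
  { Carrier = Fin n
  ; _≈_ = _≡_
  ; _+_ = _+ₙ_
  ; _*_ = _*ₙ_
  ; -_  = -ₙ_
  ; 0#  = 0ₙ
  ; 1#  = 1ₙ
  ; isCommutativeRing = record
    { isRing = record
      { +-isAbelianGroup = record
        { isGroup = record
          { isMonoid = record
            { isSemigroup = record
              { isMagma = record { isEquivalence = isEquivalence ; ∙-cong = cong₂ _+ₙ_ }
              ; assoc = +ₙ-assoc
              }
            ; identity = +ₙ-identityˡ , λ i → trans (+ₙ-comm i 0ₙ) (+ₙ-identityˡ i)
            }
          ; inverse = (λ i → trans (+ₙ-comm (-ₙ i) i) (+ₙ-inverseʳ i)) , +ₙ-inverseʳ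
          ; ⁻¹-cong = cong -ₙ_
          }
        ; comm = +ₙ-comm
        }
      ; *-cong = cong₂ _*ₙ_
      ; *-assoc = *ₙ-assoc
      ; *-identity = *ₙ-identityˡ , λ i → trans (*ₙ-comm i 1ₙ) (*ₙ-identityˡ i)
      ; distrib = *ₙ-distribˡ-+ₙ , comm∧distrˡ⇒distrʳ *ₙ-comm *ₙ-distribˡ-+ₙ
      }
    ; *-comm = *ₙ-comm
    }
  }
  where open Mod n

ℤ/-unitGraph-adj? : ∀ n .{{_ : NonZero n}} → Decidable (Adj (unitGraph (ℤ/ n)))
ℤ/-unitGraph-adj? n x y =
  ¬? (x Fin.≟ y) ×-dec Fin.any? λ z →
    (z *ₙ (x +ₙ y) Fin.≟ 1ₙ) ×-dec ((x +ₙ y) *ₙ z Fin.≟ 1ₙ)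
  where open Mod n

φ : ℕ → ℕ
φ n = length (filter (coprime? n) (map suc (upTo n)))

primes⇒nonZero : ∀ {p q} → Prime p → Prime q → NonZero (p ℕ.* q)
primes⇒nonZero {p} {q} p-prime q-prime =
  ℕ.m*n≢0 p q {{prime⇒nonZero p-prime}} {{prime⇒nonZero q-prime}}

{-# OPTIONS --safe #-}

-- Call a residue a unit or a nonunit according to whether it is prime to pq.  Since y ↦ x + y
-- permutes the residues, exactly φ(pq) of the sums x + y are units; x + x is a unit iff x is,
-- because pq is odd.  So nonunits have degree φ(pq) and units have degree φ(pq) − 1, and an edge
-- contributes √2 φ(pq), √(φ(pq)² + (φ(pq) − 1)²) or √2 (φ(pq) − 1) according to its number of
-- unit endpoints.  A sum of two nonunits is a unit iff one of them is divisible by p only and the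
-- other by q only, which gives α = (p − 1)(q − 1) edges between nonunits; the pq − φ(pq) nonunits
-- have total degree 2α + β, and the total degree of all vertices is (pq − 1) φ(pq).

module Submission where

open import Defs
open import Data.Fin.Base using (Fin; zero; suc; toℕ)
import Data.Fin.Properties as Fin
import Data.Integer.Base as ℤ
import Data.Integer.Properties as ℤ
open import Data.List.Base using (List; []; _∷_; _++_; length; filter; map; tabulate;
  allFin; applyUpTo; upTo; cartesianProduct)
import Data.List.Properties as List hiding (sum-++)
open import Data.Nat.Base as ℕ using (ℕ; zero; suc)
open import Data.Nat.Coprimality using (Coprime; coprime?; coprime-Bézout; coprime-divisor)
open import Data.Nat.Divisibility
open import Data.Nat.DivMod using (_%_; _mod_; [m+kn]%n≡m%n)
open import Data.Nat.GCD using (module Bézout)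
import Data.Nat.ListAction as List
import Data.Nat.ListAction.Properties as List
open import Data.Nat.Primality using (Prime; prime⇒nonZero; prime⇒nonTrivial;
  prime⇒irreducible; euclidsLemma; prime[2]; ¬prime[1])
import Data.Nat.Properties as ℕ
import Data.Nat.Solver as ℕ
open import Data.Product.Base using (_×_; _,_; ∃-syntax; uncurry)
open import Data.Rational.Base using (½)
import Data.Rational.Properties as ℚ
import Data.Rational.Solver as ℚ
import Data.Rational.Unnormalised.Base as ℚᵘ
import Data.Rational.Unnormalised.Properties as ℚᵘ
open import Data.Sum.Base using (inj₁; inj₂)
open import Function.Base using (_∘_; id)
open import Level using (Level)
open import Relation.Binary.Definitions using (tri<; tri≈; tri>) renaming (Decidable to Decidable₂)
open import Relation.Binary.PropositionalEquality
open import Relation.Nullary.Decidable using (Dec; yes; no; ¬?; _×-dec_)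
open import Relation.Nullary.Negation using (¬_; contradiction)
open import Relation.Unary using (Pred; Decidable)

-- An edge is listed only with its smaller endpoint first, and a sum over such pairs has no
-- translation symmetry. Doubling it and adding the diagonal gives a sum over all ordered pairs
-- weighted by `U (u + v)`, and each row of these weights is `U` over one full period. The counts
-- are stated in ℕ without subtraction; differences are formed only in ℚ. The factor p + q - 3
-- arises because the pq - φ(pq) = p + q - 1 nonunits have degree φ(pq) = α each, and the edges
-- between nonunits take up 2α of that total. The analytic obstacle is that `√` rounds down to
-- multiples of 1/(k+1) at index k, so √(2r²) and √2 · r need not have the same k-th term. Their
-- equality is the only one that requires an estimate; every other identity of reals used here holds
-- term by term in ℚ.

module _ where
  open import Algebra.Properties.Semiring.Sum ℕ.+-*-semiring
    using (sum-syntax; sum-cong-≗; ∑-distrib-+; ∑-comm; *-distribˡ-sum; *-distribʳ-sum)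
  open import Data.Nat.Base
  open import Data.Nat.Properties

  private
    variable
      κ κ′ ℓ ℓ′ : Level
      A : Set κ
      B : Set κ′
      P : Set ℓ
      Q : Set ℓ′
      m n p q : ℕ

  -- Indicators and finite sums

  ind : Dec P → ℕ
  ind (yes _) = 1
  ind (no _)  = 0

  ind-yes : (P? : Dec P) → P → ind P? ≡ 1
  ind-yes (yes _) _ = refl
  ind-yes (no ¬p) p = contradiction p ¬p

  ind-no : (P? : Dec P) → ¬ P → ind P? ≡ 0
  ind-no (yes p) ¬p = contradiction p ¬p
  ind-no (no _)  _  = refl

  ind-cong : (P? : Dec P) (Q? : Dec Q) → (P → Q) → (Q → P) → ind P? ≡ ind Q?
  ind-cong (yes p) Q? f g = sym (ind-yes Q? (f p))
  ind-cong (no ¬p) Q? f g = sym (ind-no Q? (¬p ∘ g))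

  ind-× : (P? : Dec P) (Q? : Dec Q) → ind (P? ×-dec Q?) ≡ ind P? * ind Q?
  ind-× (yes _) (yes _) = refl
  ind-× (yes _) (no _)  = refl
  ind-× (no _)  (yes _) = refl
  ind-× (no _)  (no _)  = refl

  ind-¬ : (P? : Dec P) → ind P? + ind (¬? P?) ≡ 1
  ind-¬ (yes _) = refl
  ind-¬ (no _)  = refl

  sum-filter : {P : Pred A ℓ} (P? : Decidable P) (f : A → ℕ) (xs : List A) →
               List.sum (map f (filter P? xs)) ≡ List.sum (map (λ x → ind (P? x) * f x) xs)
  sum-filter P? f []       = refl
  sum-filter P? f (x ∷ xs) with P? x
  ... | yes _ = cong₂ _+_ (sym (+-identityʳ (f x))) (sum-filter P? f xs)
  ... | no _  = sum-filter P? f xs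

  length-filter : {P : Pred A ℓ} (P? : Decidable P) (xs : List A) →
                  length (filter P? xs) ≡ List.sum (map (ind ∘ P?) xs)
  length-filter P? []       = refl
  length-filter P? (x ∷ xs) with P? x
  ... | yes _ = cong suc (length-filter P? xs)
  ... | no _  = length-filter P? xs

  sum-tabulate : (f : A → ℕ) (g : Fin n → A) →
                 List.sum (map f (tabulate g)) ≡ ∑[ i < n ] f (g i)
  sum-tabulate {n = zero}  f g = refl
  sum-tabulate {n = suc n} f g = cong (f (g zero) +_) (sum-tabulate f (g ∘ suc))

  sum-applyUpTo : (f : A → ℕ) (g : ℕ → A) (n : ℕ) →
                  List.sum (map f (applyUpTo g n)) ≡ ∑[ i < n ] f (g (toℕ i))
  sum-applyUpTo f g zero    = refl
  sum-applyUpTo f g (suc n) = cong (f (g 0) +_) (sum-applyUpTo f (g ∘ suc) n)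

  sum-cartesianProduct : (f : A × B → ℕ) (xs : List A) (ys : List B) →
    List.sum (map f (cartesianProduct xs ys)) ≡
    List.sum (map (λ x → List.sum (map (λ y → f (x , y)) ys)) xs)
  sum-cartesianProduct f []       ys = refl
  sum-cartesianProduct f (x ∷ xs) ys = begin
    List.sum (map f (map (x ,_) ys ++ cartesianProduct xs ys))
      ≡⟨ cong List.sum (List.map-++ f (map (x ,_) ys) _) ⟩
    List.sum (map f (map (x ,_) ys) ++ map f (cartesianProduct xs ys))
      ≡⟨ List.sum-++ (map f (map (x ,_) ys)) _ ⟩
    List.sum (map f (map (x ,_) ys)) + List.sum (map f (cartesianProduct xs ys))
      ≡⟨ cong₂ _+_ (cong List.sum (sym (List.map-∘ ys))) (sum-cartesianProduct f xs ys) ⟩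
    List.sum (map (λ y → f (x , y)) ys) + _ ∎
    where open ≡-Reasoning

  ∑-snoc : ∀ n (f : ℕ → ℕ) → f 0 + ∑[ i < n ] f (suc (toℕ i)) ≡ ∑[ i < n ] f (toℕ i) + f n
  ∑-snoc zero    f = +-identityʳ (f 0)
  ∑-snoc (suc n) f = trans (cong (f 0 +_) (∑-snoc n (f ∘ suc))) (sym (+-assoc (f 0) _ _))

  -- Induction on `u` reduces to a shift by one, which drops `f 0` and gains `f n`; these agree by
  -- periodicity. This takes the place of the permutation y ↦ x + y of the residues.
  ∑-translate : ∀ (f : ℕ → ℕ) → (∀ i → f (i + n) ≡ f i) → ∀ u →
                ∑[ i < n ] f (u + toℕ i) ≡ ∑[ i < n ] f (toℕ i)
  ∑-translate     f periodic zero    = refl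
  ∑-translate {n} f periodic (suc u) = trans (∑-translate (f ∘ suc) (periodic ∘ suc) u)
    (+-cancelˡ-≡ (f 0) _ _ (trans (∑-snoc n f)
      (trans (cong (∑[ i < n ] f (toℕ i) +_) (periodic 0)) (+-comm _ (f 0)))))

  ∑-+ : ∀ m n (f : ℕ → ℕ) →
        ∑[ i < m + n ] f (toℕ i) ≡ ∑[ i < m ] f (toℕ i) + ∑[ i < n ] f (m + toℕ i)
  ∑-+ zero    n f = refl
  ∑-+ (suc m) n f = trans (cong (f 0 +_) (∑-+ m n (f ∘ suc))) (sym (+-assoc (f 0) _ _))

  ∑-zero : (f : Fin n → ℕ) → (∀ i → f i ≡ 0) → ∑[ i < n ] f i ≡ 0
  ∑-zero {zero}  f f≡0 = refl
  ∑-zero {suc n} f f≡0 = cong₂ _+_ (f≡0 zero) (∑-zero (f ∘ suc) (f≡0 ∘ suc))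

  ∑-one : ∀ n → ∑[ i < n ] 1 ≡ n
  ∑-one zero    = refl
  ∑-one (suc n) = cong suc (∑-one n)

  ∑-kronecker : (u : Fin n) (f : Fin n → ℕ) → ∑[ v < n ] (ind (u Fin.≟ v) * f v) ≡ f u
  ∑-kronecker {suc n} zero f = trans
    (cong₂ _+_ (*-identityˡ (f zero)) (∑-zero {n} (λ v → ind (Fin.zero {n} Fin.≟ suc v) * f (suc v)) λ v → refl))
    (+-identityʳ (f zero))
  ∑-kronecker {suc n} (suc u) f = trans (sum-cong-≗ {n} λ v → cong (_* f (suc v))
    (ind-cong (suc u Fin.≟ suc v) (u Fin.≟ v) Fin.suc-injective (cong suc)))
    (∑-kronecker u (f ∘ suc))

  -- The range is cut into `k` blocks of length `m`, and in each block only the first number is a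
  -- multiple.
  count-multiples : ∀ m .{{_ : NonZero m}} k → ∑[ i < k * m ] ind (m ∣? toℕ i) ≡ k
  count-multiples m@(suc m′) zero    = refl
  count-multiples m@(suc m′) (suc k) = begin
    ∑[ i < m + k * m ] ind (m ∣? toℕ i)                                    ≡⟨ ∑-+ m (k * m) (λ i → ind (m ∣? i)) ⟩
    ∑[ i < m ] ind (m ∣? toℕ i) + ∑[ i < k * m ] ind (m ∣? (m + toℕ i))     ≡⟨ cong₂ _+_ first rest ⟩
    suc k ∎
    where
    open ≡-Reasoning
    first : ∑[ i < m ] ind (m ∣? toℕ i) ≡ 1
    first = cong₂ _+_ (ind-yes (m ∣? 0) (m ∣0))
      (∑-zero {m′} (λ i → ind (m ∣? suc (toℕ i))) λ i → ind-no (m ∣? _) λ m∣i →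
        <⇒≱ (s≤s (Fin.toℕ<n i)) (∣⇒≤ m∣i))
    rest : ∑[ i < k * m ] ind (m ∣? (m + toℕ i)) ≡ k
    rest = trans (sum-cong-≗ {k * m} λ i → ind-cong (m ∣? (m + toℕ i)) (m ∣? toℕ i)
        (λ m∣m+i → ∣m+n∣m⇒∣n m∣m+i ∣-refl) (∣m∣n⇒∣m+n ∣-refl))
      (count-multiples m k)

  ∑-pointwise-+ : ∀ {n} (f g h : Fin n → ℕ) → (∀ i → f i + g i ≡ h i) →
                  ∑[ i < n ] f i + ∑[ i < n ] g i ≡ ∑[ i < n ] h i
  ∑-pointwise-+ {n} f g h f+g≡h = trans (sym (∑-distrib-+ f g)) (sum-cong-≗ {n} f+g≡h)

  ∑∑-pointwise-+ : ∀ {m n} (f g h : Fin m → Fin n → ℕ) → (∀ i j → f i j + g i j ≡ h i j) →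
    ∑[ i < m ] ∑[ j < n ] f i j + ∑[ i < m ] ∑[ j < n ] g i j ≡ ∑[ i < m ] ∑[ j < n ] h i j
  ∑∑-pointwise-+ {m} {n} f g h f+g≡h = ∑-pointwise-+ {m}
    (λ i → ∑[ j < n ] f i j) (λ i → ∑[ j < n ] g i j) (λ i → ∑[ j < n ] h i j)
    (λ i → ∑-pointwise-+ {n} (f i) (g i) (h i) (f+g≡h i))

  ∑∑-cong : ∀ {m n} (f g : Fin m → Fin n → ℕ) → (∀ i j → f i j ≡ g i j) →
            ∑[ i < m ] ∑[ j < n ] f i j ≡ ∑[ i < m ] ∑[ j < n ] g i j
  ∑∑-cong {m} {n} f g f≡g = sum-cong-≗ {m} λ i → sum-cong-≗ {n} (f≡g i)

  ∑∑-* : ∀ {m n} (f : Fin m → ℕ) (g : Fin n → ℕ) →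
         ∑[ i < m ] ∑[ j < n ] (f i * g j) ≡ (∑[ i < m ] f i) * (∑[ j < n ] g j)
  ∑∑-* {m} {n} f g = trans (sum-cong-≗ {m} λ i → sym (*-distribˡ-sum {n} (f i) g))
    (sym (*-distribʳ-sum {m} (∑[ j < n ] g j) f))

  -- Units of ℤ/n

  module _ where
    open ℕ.+-*-Solver

    bézout-complement : ∀ b x n′ → (b * n′) * x + (1 + b * x) ≡ 1 + (b * x) * suc n′
    bézout-complement = solve 3 (λ b x n′ →
      b :* n′ :* x :+ (con 1 :+ b :* x) := con 1 :+ b :* x :* (con 1 :+ n′)) refl

  -- A common divisor of `n` and `x` divides `z * x`, hence `1 % n`, hence 1. Leaving `1 % n`
  -- unreduced covers n = 1 as well.
  invertible⇒coprime : ∀ n .{{_ : NonZero n}} x → IsUnit (ℤ/ n) x → Coprime n (toℕ x)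
  invertible⇒coprime n x (z , zx≡1 , _) {d} (d∣n , d∣x) = ∣1⇒≡1
    (∣n∣m%n⇒∣m d∣n (subst (d ∣_) zx%n≡1%n (%-presˡ-∣ (∣n⇒∣m*n (toℕ z) d∣x) d∣n)))
    where
    open Mod n
    zx%n≡1%n : (toℕ z * toℕ x) % n ≡ 1 % n
    zx%n≡1%n = trans (sym (toℕ-mod _)) (trans (cong toℕ zx≡1) (toℕ-mod 1))

  coprime⇒invertible : ∀ n .{{_ : NonZero n}} x → Coprime n (toℕ x) → IsUnit (ℤ/ n) x
  coprime⇒invertible n@(suc n′) x coprime = inverse (coprime-Bézout coprime)
    where
    open Mod n
    open ≡-Reasoning
    from-multiplier : ∀ b → (b * toℕ x) % n ≡ 1 % n → IsUnit (ℤ/ n) x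
    from-multiplier b bx%n≡1%n = b mod n , bx≡1 , trans (*ₙ-comm x (b mod n)) bx≡1
      where
      bx≡1 : (b mod n) *ₙ x ≡ 1ₙ
      bx≡1 = trans (*-modˡ b (toℕ x)) (mod-cong {b * toℕ x} {1} bx%n≡1%n)
    inverse : Bézout.Identity 1 n (toℕ x) → IsUnit (ℤ/ n) x
    inverse (Bézout.-+ a b 1+an≡bx) = from-multiplier b (begin
      (b * toℕ x) % n   ≡⟨ cong (_% n) 1+an≡bx ⟨
      (1 + a * n) % n   ≡⟨ [m+kn]%n≡m%n 1 a n ⟩
      1 % n             ∎)
    -- Here bx ≡ -1, so the inverse is -b, represented in ℕ by b(n - 1).
    inverse (Bézout.+- a b 1+bx≡an) = from-multiplier (b * n′) (begin
      (b * n′ * toℕ x) % n                      ≡⟨ [m+kn]%n≡m%n (b * n′ * toℕ x) a n ⟨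
      (b * n′ * toℕ x + a * n) % n              ≡⟨ cong (λ t → (b * n′ * toℕ x + t) % n) 1+bx≡an ⟨
      (b * n′ * toℕ x + (1 + b * toℕ x)) % n    ≡⟨ cong (_% n) (bézout-complement b (toℕ x) n′) ⟩
      (1 + b * toℕ x * n) % n                   ≡⟨ [m+kn]%n≡m%n 1 (b * toℕ x) n ⟩
      1 % n                                     ∎)

  ∣m+n∣n⇒∣m : ∀ {d n} m → d ∣ m + n → d ∣ n → d ∣ m
  ∣m+n∣n⇒∣m {d} {n} m d∣m+n = ∣m+n∣m⇒∣n (subst (d ∣_) (+-comm m n) d∣m+n)

  prime∤⇒coprime : Prime p → ¬ (p ∣ m) → Coprime p m
  prime∤⇒coprime p-prime p∤m {d} (d∣p , d∣m) with prime⇒irreducible p-prime d∣p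
  ... | inj₁ d≡1  = d≡1
  ... | inj₂ refl = contradiction d∣m p∤m

  prime≢1 : Prime p → p ≢ 1
  prime≢1 p-prime refl = ¬prime[1] p-prime

  prime∣prime⇒≡ : Prime p → Prime q → p ∣ q → p ≡ q
  prime∣prime⇒≡ p-prime q-prime p∣q with prime⇒irreducible q-prime p∣q
  ... | inj₁ p≡1 = contradiction p≡1 (prime≢1 p-prime)
  ... | inj₂ p≡q = p≡q

  odd-prime∣double : Prime p → ¬ (2 ∣ p) → ∀ i → p ∣ i + i → p ∣ i
  odd-prime∣double {p} p-prime p-odd i p∣i+i
    with euclidsLemma 2 i p-prime (subst (p ∣_) (cong (i +_) (sym (+-identityʳ i))) p∣i+i)
  ... | inj₁ p∣2 = contradiction (∣-reflexive (sym (prime∣prime⇒≡ p-prime prime[2] p∣2))) p-odd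
  ... | inj₂ p∣i = p∣i

  -- Kept apart from the primality assumptions so that a hypothesis on a graph can mention `U` by
  -- itself. The indicators live on ℕ rather than on residues, so that sums `u + v` enter them
  -- unreduced.
  module Units (p q : ℕ) where

    Unit : ℕ → Set
    Unit i = ¬ (p ∣ i) × ¬ (q ∣ i)

    unit? : ∀ i → Dec (Unit i)
    unit? i = ¬? (p ∣? i) ×-dec ¬? (q ∣? i)

    U N : ℕ → ℕ
    U i = ind (unit? i)
    N i = ind (¬? (unit? i))

    U+N≡1 : ∀ i → U i + N i ≡ 1
    U+N≡1 i = ind-¬ (unit? i)

    UN≡0 : ∀ i → U i * N i ≡ 0
    UN≡0 i with unit? i
    ... | yes _ = refl
    ... | no  _ = refl

  -- Sums over edges

  module _ where
    open ℕ.+-*-Solver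

    double : ∀ x → x + x ≡ 2 * x
    double = solve 1 (λ x → x :+ x := con 2 :* x) refl

  module EdgeSum (G : SimpleGraph (Fin n) ℓ) (adj? : Decidable₂ (Adj G)) where

    edgeSum : (Fin n → Fin n → ℕ) → ℕ
    edgeSum X = List.sum (map (uncurry X) (edges G adj?))

    module _ (X : Fin n → Fin n → ℕ) where
      open ≡-Reasoning

      weight : Fin n → Fin n → ℕ
      weight u v = ind (u Fin.<? v) * ind (adj? u v) * X u v

      edgeSum-∑ : edgeSum X ≡ ∑[ u < n ] ∑[ v < n ] weight u v
      edgeSum-∑ = begin
        edgeSum X
          ≡⟨ sum-filter edge? (uncurry X) (cartesianProduct (allFin n) (allFin n)) ⟩
        List.sum (map (λ e → ind (edge? e) * uncurry X e) (cartesianProduct (allFin n) (allFin n)))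
          ≡⟨ sum-cartesianProduct (λ e → ind (edge? e) * uncurry X e) (allFin n) (allFin n) ⟩
        List.sum (map (λ u → List.sum (map (λ v → ind (edge? (u , v)) * X u v) (allFin n))) (allFin n))
          ≡⟨ sum-tabulate (λ u → List.sum (map (λ v → ind (edge? (u , v)) * X u v) (allFin n))) id ⟩
        ∑[ u < n ] List.sum (map (λ v → ind (edge? (u , v)) * X u v) (allFin n))
          ≡⟨ sum-cong-≗ {n} (λ u → sum-tabulate (λ v → ind (edge? (u , v)) * X u v) id) ⟩
        ∑[ u < n ] ∑[ v < n ] (ind (edge? (u , v)) * X u v)
          ≡⟨ ∑∑-cong {n} {n} _ weight (λ u v → cong (_* X u v) (ind-× (u Fin.<? v) (adj? u v))) ⟩
        ∑[ u < n ] ∑[ v < n ] weight u v ∎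
        where
        edge? : ∀ e → Dec _
        edge? = λ ((u , v) : Fin n × Fin n) → (u Fin.<? v) ×-dec adj? u v

      -- Exchanging the summations in a second copy turns u < v into v < u. The two copies together
      -- meet each ordered pair of distinct vertices once, and the diagonal vanishes by
      -- irreflexivity.
      handshake : (∀ u v → X u v ≡ X v u) →
                  2 * edgeSum X ≡ ∑[ u < n ] ∑[ v < n ] (ind (adj? u v) * X u v)
      handshake X-sym = begin
        2 * edgeSum X
          ≡⟨ double (edgeSum X) ⟨
        edgeSum X + edgeSum X
          ≡⟨ cong₂ _+_ edgeSum-∑ (trans edgeSum-∑ (∑-comm {n} {n} weight)) ⟩
        ∑[ u < n ] ∑[ v < n ] weight u v + ∑[ u < n ] ∑[ v < n ] weight v u
          ≡⟨ ∑∑-pointwise-+ {n} {n} weight (λ u v → weight v u) _ both ⟩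
        ∑[ u < n ] ∑[ v < n ] (ind (adj? u v) * X u v) ∎
        where
        adj-sym : ∀ u v → ind (adj? v u) ≡ ind (adj? u v)
        adj-sym u v = ind-cong (adj? v u) (adj? u v) (SimpleGraph.symmetric G) (SimpleGraph.symmetric G)
        both : ∀ u v → weight u v + weight v u ≡ ind (adj? u v) * X u v
        both u v with Fin.<-cmp u v
        ... | tri< u<v _ v≮u rewrite ind-yes (u Fin.<? v) u<v | ind-no (v Fin.<? u) v≮u
            | *-identityˡ (ind (adj? u v)) = +-identityʳ _
        ... | tri> u≮v _ v<u rewrite ind-no (u Fin.<? v) u≮v | ind-yes (v Fin.<? u) v<u
            | *-identityˡ (ind (adj? v u)) = cong₂ _*_ (adj-sym u v) (X-sym v u)
        ... | tri≈ u≮u refl _ rewrite ind-no (u Fin.<? u) u≮u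
            | ind-no (adj? u u) (SimpleGraph.irreflexive G) = refl

    edgeSum-+ : (X Y Z : Fin n → Fin n → ℕ) → (∀ u v → X u v + Y u v ≡ Z u v) →
                edgeSum X + edgeSum Y ≡ edgeSum Z
    edgeSum-+ X Y Z X+Y≡Z = trans (cong₂ _+_ (edgeSum-∑ X) (edgeSum-∑ Y))
      (trans (∑∑-pointwise-+ {n} {n} (weight X) (weight Y) (weight Z)
        (λ u v → trans (sym (*-distribˡ-+ (ind (u Fin.<? v) * ind (adj? u v)) (X u v) (Y u v)))
          (cong (ind (u Fin.<? v) * ind (adj? u v) *_) (X+Y≡Z u v))))
      (sym (edgeSum-∑ Z)))

  -- Counting residues modulo pq.

  module OddPrimes (p q : ℕ)
    (p-prime : Prime p) (q-prime : Prime q) (p-odd : ¬ (2 ∣ p)) (q-odd : ¬ (2 ∣ q)) (p≢q : p ≢ q)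
    where

    open Units p q public

    instance
      p≢0 = prime⇒nonZero p-prime
      q≢0 = prime⇒nonZero q-prime
      pq≢0 = primes⇒nonZero p-prime q-prime

    p′ q′ : ℕ
    p′ = pred p
    q′ = pred q

    unit-double : ∀ i → U (i + i) ≡ U i
    unit-double i = ind-cong (unit? (i + i)) (unit? i)
      (λ (p∤ , q∤) → (λ p∣i → p∤ (∣m∣n⇒∣m+n p∣i p∣i)) , (λ q∣i → q∤ (∣m∣n⇒∣m+n q∣i q∣i)))
      (λ (p∤ , q∤) → p∤ ∘ odd-prime∣double p-prime p-odd i , q∤ ∘ odd-prime∣double q-prime q-odd i)

    p∣pq : p ∣ p * q
    p∣pq = m∣m*n q

    q∣pq : q ∣ p * q
    q∣pq = n∣m*n p

    unit-periodic : ∀ i → U (i + p * q) ≡ U i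
    unit-periodic i = ind-cong (unit? (i + p * q)) (unit? i)
      (λ (p∤ , q∤) → (λ p∣i → p∤ (∣m∣n⇒∣m+n p∣i p∣pq)) , (λ q∣i → q∤ (∣m∣n⇒∣m+n q∣i q∣pq)))
      (λ (p∤ , q∤) → (λ p∣ → p∤ (∣m+n∣n⇒∣m i p∣ p∣pq)) , (λ q∣ → q∤ (∣m+n∣n⇒∣m i q∣ q∣pq)))

    coprime⇒unit : ∀ {m} → Coprime (p * q) m → Unit m
    coprime⇒unit coprime =
      (λ p∣m → prime≢1 p-prime (coprime (p∣pq , p∣m))) ,
      (λ q∣m → prime≢1 q-prime (coprime (q∣pq , q∣m)))

    -- A common divisor `d` of `p * q` and `m` is prime to `p`, because p ∤ m; so it divides `q`,
    -- and then q ∤ m forces d = 1.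
    unit⇒coprime : ∀ {m} → Unit m → Coprime (p * q) m
    unit⇒coprime {m} (p∤m , q∤m) {d} (d∣pq , d∣m) = prime∤⇒coprime q-prime q∤m
      (coprime-divisor d⊥p d∣pq , d∣m)
      where
      d⊥p : Coprime d p
      d⊥p (e∣d , e∣p) = prime∤⇒coprime p-prime p∤m (e∣p , ∣-trans e∣d d∣m)

    open Mod (p * q)

    isUnit⇒unit : ∀ u v → IsUnit (ℤ/ (p * q)) (u +ₙ v) → Unit (toℕ u + toℕ v)
    isUnit⇒unit u v unit with p∤ , q∤ ← coprime⇒unit (invertible⇒coprime (p * q) (u +ₙ v) unit) =
      p∤ ∘ reduce p∣pq , q∤ ∘ reduce q∣pq
      where
      reduce : ∀ {d} → d ∣ p * q → d ∣ toℕ u + toℕ v → d ∣ toℕ (u +ₙ v)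
      reduce {d} d∣pq d∣ = subst (d ∣_) (sym (toℕ-mod (toℕ u + toℕ v))) (%-presˡ-∣ d∣ d∣pq)

    unit⇒isUnit : ∀ u v → Unit (toℕ u + toℕ v) → IsUnit (ℤ/ (p * q)) (u +ₙ v)
    unit⇒isUnit u v (p∤ , q∤) = coprime⇒invertible (p * q) (u +ₙ v)
      (unit⇒coprime (p∤ ∘ lift p∣pq , q∤ ∘ lift q∣pq))
      where
      lift : ∀ {d} → d ∣ p * q → d ∣ toℕ (u +ₙ v) → d ∣ toℕ u + toℕ v
      lift {d} d∣pq d∣ = ∣n∣m%n⇒∣m d∣pq (subst (d ∣_) (toℕ-mod (toℕ u + toℕ v)) d∣)

    -- A row of the adjacency matrix falls short of a translate of `U` only on the diagonal, where
    -- loops are excluded. The added term restores them; it can be written with `U (toℕ v)` since u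
    -- + u is a unit exactly when u is.
    unitGraph-adjacency : ∀ u v →
      ind (ℤ/-unitGraph-adj? (p * q) u v) + ind (u Fin.≟ v) * U (toℕ v) ≡ U (toℕ u + toℕ v)
    unitGraph-adjacency u v = split (u Fin.≟ v)
      where
      adj? : Decidable₂ (Adj (unitGraph (ℤ/ (p * q))))
      adj? = ℤ/-unitGraph-adj? (p * q)
      split : (u≟v : Dec (u ≡ v)) → ind (adj? u v) + ind u≟v * U (toℕ v) ≡ U (toℕ u + toℕ v)
      split (yes refl) = trans (cong₂ _+_ (ind-no (adj? u u) λ (u≢u , _) → u≢u refl) (*-identityˡ _))
        (sym (unit-double (toℕ u)))
      split (no u≢v) = trans (+-identityʳ _) (ind-cong (adj? u v) (unit? (toℕ u + toℕ v))
        (λ (_ , unit) → isUnit⇒unit u v unit) (λ unit → u≢v , unit⇒isUnit u v unit))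

    a b ā b̄ : ℕ → ℕ
    a i = ind (p ∣? i)
    b i = ind (q ∣? i)
    ā i = ind (¬? (p ∣? i))
    b̄ i = ind (¬? (q ∣? i))

    ∑a : ∑[ i < p * q ] a (toℕ i) ≡ q
    ∑a = subst (λ n → ∑[ i < n ] a (toℕ i) ≡ q) (*-comm q p) (count-multiples p q)

    ∑b : ∑[ i < p * q ] b (toℕ i) ≡ p
    ∑b = count-multiples q p

    ab : ∀ i → a i * b i ≡ ind (p * q ∣? i)
    ab i = trans (sym (ind-× (p ∣? i) (q ∣? i))) (ind-cong ((p ∣? i) ×-dec (q ∣? i)) (p * q ∣? i)
      (λ (p∣i , q∣i) → pq∣ p∣i q∣i) (λ pq∣i → ∣-trans p∣pq pq∣i , ∣-trans q∣pq pq∣i))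
      where
      pq∣ : p ∣ i → q ∣ i → p * q ∣ i
      pq∣ (divides k refl) q∣kp with euclidsLemma k p q-prime q∣kp
      ... | inj₁ q∣k = subst (_∣ k * p) (*-comm q p) (*-monoˡ-∣ p q∣k)
      ... | inj₂ q∣p = contradiction (sym (prime∣prime⇒≡ q-prime p-prime q∣p)) p≢q

    ∑ab : ∑[ i < p * q ] (a (toℕ i) * b (toℕ i)) ≡ 1
    ∑ab = trans (sum-cong-≗ (λ (i : Fin (p * q)) → ab (toℕ i)))
      (subst (λ n → ∑[ i < n ] ind (p * q ∣? toℕ i) ≡ 1) (*-identityˡ (p * q)) (count-multiples (p * q) 1))

    module _ where
      open ≡-Reasoning

      -- Of the `q` multiples of `p` below pq, only 0 is divisible by `q`.
      ∑ab̄ : ∑[ i < p * q ] (a (toℕ i) * b̄ (toℕ i)) ≡ q′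
      ∑ab̄ = suc-injective (begin
        suc (∑[ i < p * q ] (a (toℕ i) * b̄ (toℕ i)))
          ≡⟨ cong (_+ ∑[ i < p * q ] (a (toℕ i) * b̄ (toℕ i))) ∑ab ⟨
        ∑[ i < p * q ] (a (toℕ i) * b (toℕ i)) + ∑[ i < p * q ] (a (toℕ i) * b̄ (toℕ i))
          ≡⟨ ∑-pointwise-+ {p * q} (λ i → a (toℕ i) * b (toℕ i)) (λ i → a (toℕ i) * b̄ (toℕ i))
               (λ i → a (toℕ i)) (λ i → split (toℕ i)) ⟩
        ∑[ i < p * q ] a (toℕ i)   ≡⟨ ∑a ⟩
        q                          ≡⟨ suc-pred q ⟨
        suc q′                     ∎)
        where
        split : ∀ i → a i * b i + a i * b̄ i ≡ a i
        split i = trans (sym (*-distribˡ-+ (a i) (b i) (b̄ i)))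
          (trans (cong (a i *_) (ind-¬ (q ∣? i))) (*-identityʳ (a i)))

      ∑āb : ∑[ i < p * q ] (ā (toℕ i) * b (toℕ i)) ≡ p′
      ∑āb = suc-injective (begin
        suc (∑[ i < p * q ] (ā (toℕ i) * b (toℕ i)))
          ≡⟨ cong (_+ ∑[ i < p * q ] (ā (toℕ i) * b (toℕ i))) ∑ab ⟨
        ∑[ i < p * q ] (a (toℕ i) * b (toℕ i)) + ∑[ i < p * q ] (ā (toℕ i) * b (toℕ i))
          ≡⟨ ∑-pointwise-+ {p * q} (λ i → a (toℕ i) * b (toℕ i)) (λ i → ā (toℕ i) * b (toℕ i))
               (λ i → b (toℕ i)) (λ i → split (toℕ i)) ⟩
        ∑[ i < p * q ] b (toℕ i)   ≡⟨ ∑b ⟩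
        p                          ≡⟨ suc-pred p ⟨
        suc p′                     ∎)
        where
        split : ∀ i → a i * b i + ā i * b i ≡ b i
        split i = trans (sym (*-distribʳ-+ (b i) (a i) (ā i)))
          (trans (cong (_* b i) (ind-¬ (p ∣? i))) (*-identityˡ (b i)))

    -- Splitting the nonunits asymmetrically counts them as `q′ + p`, which avoids the subtraction
    -- of inclusion and exclusion.
    ab̄+b≡N : ∀ i → a i * b̄ i + b i ≡ N i
    ab̄+b≡N i with p ∣? i | q ∣? i
    ... | yes _ | yes _ = refl
    ... | yes _ | no  _ = refl
    ... | no  _ | yes _ = refl
    ... | no  _ | no  _ = refl

    ∑N : ∑[ i < p * q ] N (toℕ i) ≡ q′ + p
    ∑N = trans
      (sym (∑-pointwise-+ {p * q} (λ i → a (toℕ i) * b̄ (toℕ i)) (λ i → b (toℕ i)) (λ i → N (toℕ i))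
        (λ i → ab̄+b≡N (toℕ i))))
      (cong₂ _+_ ∑ab̄ ∑b)

    ∑U : ∑[ i < p * q ] U (toℕ i) ≡ p′ * q′
    ∑U = +-cancelʳ-≡ (q′ + p) _ _ (begin
      ∑[ i < p * q ] U (toℕ i) + (q′ + p)
        ≡⟨ cong (∑[ i < p * q ] U (toℕ i) +_) ∑N ⟨
      ∑[ i < p * q ] U (toℕ i) + ∑[ i < p * q ] N (toℕ i)
        ≡⟨ ∑-pointwise-+ {p * q} (λ i → U (toℕ i)) (λ i → N (toℕ i)) (λ _ → 1) (λ i → U+N≡1 (toℕ i)) ⟩
      ∑[ i < p * q ] 1
        ≡⟨ ∑-one (p * q) ⟩
      p * q
        ≡⟨ cong₂ _*_ (suc-pred p) (suc-pred q) ⟨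
      suc p′ * suc q′
        ≡⟨ solve 2 (λ x y → (con 1 :+ x) :* (con 1 :+ y) := x :* y :+ (y :+ (con 1 :+ x))) refl p′ q′ ⟩
      p′ * q′ + (q′ + suc p′)
        ≡⟨ cong (λ t → p′ * q′ + (q′ + t)) (suc-pred p) ⟩
      p′ * q′ + (q′ + p) ∎)
      where
      open ≡-Reasoning
      open ℕ.+-*-Solver

    ∑U[u+] : ∀ u → ∑[ i < p * q ] U (u + toℕ i) ≡ p′ * q′
    ∑U[u+] u = trans (∑-translate U unit-periodic u) ∑U

    φ≡ : φ (p * q) ≡ p′ * q′
    φ≡ = begin
      φ (p * q)
        ≡⟨ length-filter coprime-to-pq? (map suc (upTo (p * q))) ⟩
      List.sum (map (ind ∘ coprime-to-pq?) (map suc (upTo (p * q))))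
        ≡⟨ cong List.sum (List.map-∘ (upTo (p * q))) ⟨
      List.sum (map (ind ∘ coprime-to-pq? ∘ suc) (upTo (p * q)))
        ≡⟨ sum-applyUpTo (ind ∘ coprime-to-pq? ∘ suc) id (p * q) ⟩
      ∑[ i < p * q ] ind (coprime-to-pq? (1 + toℕ i))
        ≡⟨ sum-cong-≗ {p * q} (λ i →
             ind-cong (coprime-to-pq? (1 + toℕ i)) (unit? (1 + toℕ i)) coprime⇒unit unit⇒coprime) ⟩
      ∑[ i < p * q ] U (1 + toℕ i)
        -- `φ` runs over 1, ..., pq instead of 0, ..., pq - 1; the offset is one more translation
        -- over a full period.
        ≡⟨ ∑U[u+] 1 ⟩
      p′ * q′ ∎
      where
      open ≡-Reasoning
      coprime-to-pq? : Decidable (Coprime (p * q))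
      coprime-to-pq? = coprime? (p * q)

    common-p : ∀ {i j} → p ∣ i → p ∣ j → U (i + j) ≡ 0
    common-p {i} {j} p∣i p∣j = ind-no (unit? (i + j)) λ (p∤i+j , _) → p∤i+j (∣m∣n⇒∣m+n p∣i p∣j)

    common-q : ∀ {i j} → q ∣ i → q ∣ j → U (i + j) ≡ 0
    common-q {i} {j} q∣i q∣j = ind-no (unit? (i + j)) λ (_ , q∤i+j) → q∤i+j (∣m∣n⇒∣m+n q∣i q∣j)

    -- A prime dividing both `i` and `j` divides their sum. If there is none, each of `p` and `q`
    -- divides exactly one of the two nonunits, hence not the sum.
    unit-sum-of-nonunits : ∀ i j →
      U (i + j) * (N i * N j) ≡ a i * b̄ i * (ā j * b j) + ā i * b i * (a j * b̄ j)
    unit-sum-of-nonunits i j with p ∣? i | q ∣? i | p ∣? j | q ∣? j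
    ... | no  p∤i | no  q∤i | _       | _       = *-zeroʳ (U (i + j))
    ... | yes p∣i | yes q∣i | no  p∤j | no  q∤j = *-zeroʳ (U (i + j))
    ... | yes p∣i | no  q∤i | no  p∤j | no  q∤j = *-zeroʳ (U (i + j))
    ... | no  p∤i | yes q∣i | no  p∤j | no  q∤j = *-zeroʳ (U (i + j))
    ... | yes p∣i | yes q∣i | yes p∣j | yes q∣j = cong (_* 1) (common-p p∣i p∣j)
    ... | yes p∣i | yes q∣i | yes p∣j | no  q∤j = cong (_* 1) (common-p p∣i p∣j)
    ... | yes p∣i | yes q∣i | no  p∤j | yes q∣j = cong (_* 1) (common-q q∣i q∣j)
    ... | yes p∣i | no  q∤i | yes p∣j | yes q∣j = cong (_* 1) (common-p p∣i p∣j)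
    ... | yes p∣i | no  q∤i | yes p∣j | no  q∤j = cong (_* 1) (common-p p∣i p∣j)
    ... | yes p∣i | no  q∤i | no  p∤j | yes q∣j = cong (_* 1) (ind-yes (unit? (i + j))
            ((λ p∣i+j → p∤j (∣m+n∣m⇒∣n p∣i+j p∣i)) , (λ q∣i+j → q∤i (∣m+n∣n⇒∣m i q∣i+j q∣j))))
    ... | no  p∤i | yes q∣i | yes p∣j | yes q∣j = cong (_* 1) (common-q q∣i q∣j)
    ... | no  p∤i | yes q∣i | yes p∣j | no  q∤j = cong (_* 1) (ind-yes (unit? (i + j))
            ((λ p∣i+j → p∤i (∣m+n∣n⇒∣m i p∣i+j p∣j)) , (λ q∣i+j → q∤j (∣m+n∣m⇒∣n q∣i+j q∣i))))
    ... | no  p∤i | yes q∣i | no  p∤j | yes q∣j = cong (_* 1) (common-q q∣i q∣j)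

    -- Stated for any graph with the adjacency of the unit graph, so that ℤ/ is never unfolded.
    module UnitSumGraph (G : SimpleGraph (Fin (p * q)) ℓ) (adj? : Decidable₂ (Adj G))
      (adjacency : ∀ u v → ind (adj? u v) + ind (u Fin.≟ v) * U (toℕ v) ≡ U (toℕ u + toℕ v))
      where

      open EdgeSum G adj? public
      open ≡-Reasoning

      U′ N′ : Fin (p * q) → ℕ
      U′ u = U (toℕ u)
      N′ u = N (toℕ u)

      degree-U : ∀ u → degree G adj? u + U′ u ≡ p′ * q′
      degree-U u = begin
        degree G adj? u + U′ u
          ≡⟨ cong₂ _+_ (trans (length-filter (adj? u) (allFin (p * q))) (sum-tabulate (ind ∘ adj? u) id))
                       (sym (∑-kronecker u U′)) ⟩
        ∑[ v < p * q ] ind (adj? u v) + ∑[ v < p * q ] (ind (u Fin.≟ v) * U′ v)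
          ≡⟨ ∑-pointwise-+ {p * q} (λ v → ind (adj? u v)) (λ v → ind (u Fin.≟ v) * U′ v)
               (λ v → U (toℕ u + toℕ v)) (adjacency u) ⟩
        ∑[ v < p * q ] U (toℕ u + toℕ v)
          ≡⟨ ∑U[u+] (toℕ u) ⟩
        p′ * q′ ∎

      -- The pairs are ordered and include u = v, so that a weight depending on one endpoint sums by
      -- full rows.
      unitPairs : (Fin (p * q) → Fin (p * q) → ℕ) → ℕ
      unitPairs X = ∑[ u < p * q ] ∑[ v < p * q ] (U (toℕ u + toℕ v) * X u v)

      unitPairs-+ : ∀ X Y Z → (∀ u v → X u v + Y u v ≡ Z u v) → unitPairs X + unitPairs Y ≡ unitPairs Z
      unitPairs-+ X Y Z X+Y≡Z = ∑∑-pointwise-+ {p * q} {p * q}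
        (λ u v → W u v * X u v) (λ u v → W u v * Y u v) (λ u v → W u v * Z u v)
        (λ u v → trans (sym (*-distribˡ-+ (W u v) (X u v) (Y u v))) (cong (W u v *_) (X+Y≡Z u v)))
        where
        W : Fin (p * q) → Fin (p * q) → ℕ
        W u v = U (toℕ u + toℕ v)

      unitPairs-flip : ∀ X → unitPairs (λ u v → X v u) ≡ unitPairs X
      unitPairs-flip X = trans (∑-comm {p * q} {p * q} (λ u v → U (toℕ u + toℕ v) * X v u))
        (∑∑-cong {p * q} {p * q} (λ u v → U (toℕ v + toℕ u) * X u v) (λ u v → U (toℕ u + toℕ v) * X u v)
          (λ u v → cong (λ t → U t * X u v) (+-comm (toℕ v) (toℕ u))))

      unitPairs-left : ∀ f → unitPairs (λ u _ → f u) ≡ (∑[ u < p * q ] f u) * (p′ * q′)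
      unitPairs-left f = trans (sum-cong-≗ {p * q} row) (sym (*-distribʳ-sum {p * q} (p′ * q′) f))
        where
        row : ∀ u → ∑[ v < p * q ] (U (toℕ u + toℕ v) * f u) ≡ f u * (p′ * q′)
        row u = begin
          ∑[ v < p * q ] (U (toℕ u + toℕ v) * f u)    ≡⟨ *-distribʳ-sum {p * q} (f u) (λ v → U (toℕ u + toℕ v)) ⟨
          ∑[ v < p * q ] U (toℕ u + toℕ v) * f u      ≡⟨ cong (_* f u) (∑U[u+] (toℕ u)) ⟩
          p′ * q′ * f u                               ≡⟨ *-comm (p′ * q′) (f u) ⟩
          f u * (p′ * q′)                             ∎

      -- The Kronecker delta writes the diagonal as a double sum, which `adjacency` then merges with
      -- the handshake sum pair by pair.
      edgeSum-unitPairs : ∀ X → (∀ u v → X u v ≡ X v u) →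
        2 * edgeSum X + ∑[ u < p * q ] (U′ u * X u u) ≡ unitPairs X
      edgeSum-unitPairs X X-sym = begin
        2 * edgeSum X + ∑[ u < p * q ] (U′ u * X u u)
          ≡⟨ cong₂ _+_ (handshake X X-sym) (sum-cong-≗ {p * q} λ u → sym (∑-kronecker u (λ v → U′ v * X u v))) ⟩
        ∑[ u < p * q ] ∑[ v < p * q ] (ind (adj? u v) * X u v) +
        ∑[ u < p * q ] ∑[ v < p * q ] (ind (u Fin.≟ v) * (U′ v * X u v))
          ≡⟨ ∑∑-pointwise-+ {p * q} {p * q} (λ u v → ind (adj? u v) * X u v)
               (λ u v → ind (u Fin.≟ v) * (U′ v * X u v)) (λ u v → U (toℕ u + toℕ v) * X u v) merge ⟩
        unitPairs X ∎
        where
        merge : ∀ u v → ind (adj? u v) * X u v + ind (u Fin.≟ v) * (U′ v * X u v) ≡ U (toℕ u + toℕ v) * X u v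
        merge u v = begin
          ind (adj? u v) * X u v + ind (u Fin.≟ v) * (U′ v * X u v)
            ≡⟨ cong (ind (adj? u v) * X u v +_) (*-assoc (ind (u Fin.≟ v)) (U′ v) (X u v)) ⟨
          ind (adj? u v) * X u v + ind (u Fin.≟ v) * U′ v * X u v
            ≡⟨ *-distribʳ-+ (X u v) (ind (adj? u v)) (ind (u Fin.≟ v) * U′ v) ⟨
          (ind (adj? u v) + ind (u Fin.≟ v) * U′ v) * X u v
            ≡⟨ cong (_* X u v) (adjacency u v) ⟩
          U (toℕ u + toℕ v) * X u v ∎

      -- Meant for weights whose diagonal contains a factor `N′ u`, which vanishes at units. That
      -- covers edges with a nonunit endpoint; the edges between units are found as the remainder of
      -- all edges.
      edgeSum-offDiagonal : ∀ X → (∀ u v → X u v ≡ X v u) → (∀ u → U′ u * X u u ≡ 0) →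
        2 * edgeSum X ≡ unitPairs X
      edgeSum-offDiagonal X X-sym UX≡0 = begin
        2 * edgeSum X
          ≡⟨ +-identityʳ _ ⟨
        2 * edgeSum X + 0
          ≡⟨ cong (2 * edgeSum X +_) (∑-zero {p * q} (λ u → U′ u * X u u) UX≡0) ⟨
        2 * edgeSum X + ∑[ u < p * q ] (U′ u * X u u)
          ≡⟨ edgeSum-unitPairs X X-sym ⟩
        unitPairs X ∎

      -- Counting edges by their number of unit endpoints.

      NN NU UU : Fin (p * q) → Fin (p * q) → ℕ
      NN u v = N′ u * N′ v
      NU u v = N′ u * U′ v + U′ u * N′ v
      UU u v = U′ u * U′ v

      2*edgeSum-NN : 2 * edgeSum NN ≡ unitPairs NN
      2*edgeSum-NN = edgeSum-offDiagonal NN (λ u v → *-comm (N′ u) (N′ v))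
        λ u → trans (sym (*-assoc (U′ u) (N′ u) (N′ u))) (cong (_* N′ u) (UN≡0 (toℕ u)))

      2*edgeSum-NU : 2 * edgeSum NU ≡ unitPairs NU
      2*edgeSum-NU = edgeSum-offDiagonal NU
        (λ u v → trans (+-comm (N′ u * U′ v) (U′ u * N′ v))
                       (cong₂ _+_ (*-comm (U′ u) (N′ v)) (*-comm (N′ u) (U′ v))))
        (λ u → diagonal (U′ u) (N′ u) (UN≡0 (toℕ u)))
        where
        open ℕ.+-*-Solver
        diagonal : ∀ x y → x * y ≡ 0 → x * (y * x + x * y) ≡ 0
        diagonal x y xy≡0 = trans
          (solve 2 (λ x y → x :* (y :* x :+ x :* y) := (x :* y) :* (con 2 :* x)) refl x y)
          (cong (_* (2 * x)) xy≡0)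

      -- For either order of the endpoints the double sum factors into the q - 1 residues divisible
      -- by `p` only times the p - 1 divisible by `q` only.
      edgeSum-NN : edgeSum NN ≡ p′ * q′
      edgeSum-NN = *-cancelˡ-≡ _ _ 2 (begin
        2 * edgeSum NN
          ≡⟨ 2*edgeSum-NN ⟩
        unitPairs NN
          ≡⟨ ∑∑-pointwise-+ {p * q} {p * q} (λ u v → onlyP u * onlyQ v) (λ u v → onlyQ u * onlyP v)
               (λ u v → U (toℕ u + toℕ v) * NN u v) (λ u v → sym (unit-sum-of-nonunits (toℕ u) (toℕ v))) ⟨
        ∑[ u < p * q ] ∑[ v < p * q ] (onlyP u * onlyQ v) + ∑[ u < p * q ] ∑[ v < p * q ] (onlyQ u * onlyP v)
          ≡⟨ cong₂ _+_ (∑∑-* {p * q} {p * q} onlyP onlyQ) (∑∑-* {p * q} {p * q} onlyQ onlyP) ⟩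
        ∑[ u < p * q ] onlyP u * ∑[ v < p * q ] onlyQ v + ∑[ u < p * q ] onlyQ u * ∑[ v < p * q ] onlyP v
          ≡⟨ cong₂ (λ x y → x * y + y * x) ∑ab̄ ∑āb ⟩
        q′ * p′ + p′ * q′
          ≡⟨ cong (_+ p′ * q′) (*-comm q′ p′) ⟩
        p′ * q′ + p′ * q′
          ≡⟨ double (p′ * q′) ⟩
        2 * (p′ * q′) ∎)
        where
        onlyP onlyQ : Fin (p * q) → ℕ
        onlyP u = a (toℕ u) * b̄ (toℕ u)
        onlyQ u = ā (toℕ u) * b (toℕ u)

      -- Both sides are the total degree of the nonunits.
      edgeSum-NU : edgeSum NU + 2 * (p′ * q′) ≡ (q′ + p) * (p′ * q′)
      edgeSum-NU = *-cancelˡ-≡ _ _ 2 (begin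
        2 * (edgeSum NU + 2 * (p′ * q′))
          ≡⟨ *-distribˡ-+ 2 (edgeSum NU) (2 * (p′ * q′)) ⟩
        2 * edgeSum NU + 2 * (2 * (p′ * q′))
          ≡⟨ cong₂ _+_ 2*edgeSum-NU (cong (2 *_) (trans (cong (2 *_) (sym edgeSum-NN)) 2*edgeSum-NN)) ⟩
        unitPairs NU + 2 * unitPairs NN
          ≡⟨ cong (unitPairs NU +_) (trans (sym (double (unitPairs NN)))
               (unitPairs-+ NN NN (λ u v → NN u v + NN u v) λ _ _ → refl)) ⟩
        unitPairs NU + unitPairs (λ u v → NN u v + NN u v)
          ≡⟨ unitPairs-+ NU (λ u v → NN u v + NN u v) (λ u v → N′ u + N′ v) regroup ⟩
        unitPairs (λ u v → N′ u + N′ v)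
          ≡⟨ unitPairs-+ (λ u _ → N′ u) (λ _ v → N′ v) (λ u v → N′ u + N′ v) (λ _ _ → refl) ⟨
        unitPairs (λ u _ → N′ u) + unitPairs (λ _ v → N′ v)
          ≡⟨ cong₂ _+_ left (trans (unitPairs-flip (λ u _ → N′ u)) left) ⟩
        (q′ + p) * (p′ * q′) + (q′ + p) * (p′ * q′)
          ≡⟨ double ((q′ + p) * (p′ * q′)) ⟩
        2 * ((q′ + p) * (p′ * q′)) ∎)
        where
        open ℕ.+-*-Solver
        left : unitPairs (λ u _ → N′ u) ≡ (q′ + p) * (p′ * q′)
        left = trans (unitPairs-left N′) (cong (_* (p′ * q′)) ∑N)
        regroup : ∀ u v → NU u v + (NN u v + NN u v) ≡ N′ u + N′ v
        regroup u v = begin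
          NU u v + (NN u v + NN u v)
            ≡⟨ solve 4 (λ x y x′ y′ → x :* y′ :+ x′ :* y :+ (x :* y :+ x :* y) := x :* (y′ :+ y) :+ (x′ :+ x) :* y)
                 refl (N′ u) (N′ v) (U′ u) (U′ v) ⟩
          N′ u * (U′ v + N′ v) + (U′ u + N′ u) * N′ v
            ≡⟨ cong₂ (λ x y → N′ u * x + y * N′ v) (U+N≡1 (toℕ v)) (U+N≡1 (toℕ u)) ⟩
          N′ u * 1 + 1 * N′ v
            ≡⟨ cong₂ _+_ (*-identityʳ (N′ u)) (*-identityˡ (N′ v)) ⟩
          N′ u + N′ v ∎

      -- The summand `p′ * q′` on the left counts the diagonal pairs (u, u), one for each unit.
      edgeSum-1 : 2 * edgeSum (λ _ _ → 1) + p′ * q′ ≡ p * q * (p′ * q′)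
      edgeSum-1 = begin
        2 * edgeSum (λ _ _ → 1) + p′ * q′
          ≡⟨ cong (2 * edgeSum (λ _ _ → 1) +_) (trans (sum-cong-≗ {p * q} (λ u → *-identityʳ (U′ u))) ∑U) ⟨
        2 * edgeSum (λ _ _ → 1) + ∑[ u < p * q ] (U′ u * 1)
          ≡⟨ edgeSum-unitPairs (λ _ _ → 1) (λ _ _ → refl) ⟩
        unitPairs (λ _ _ → 1)
          ≡⟨ unitPairs-left (λ _ → 1) ⟩
        ∑[ u < p * q ] 1 * (p′ * q′)
          ≡⟨ cong (_* (p′ * q′)) (∑-one (p * q)) ⟩
        p * q * (p′ * q′) ∎

      edgeSum-NN+NU+UU : edgeSum NN + edgeSum NU + edgeSum UU ≡ edgeSum (λ _ _ → 1)
      edgeSum-NN+NU+UU = trans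
        (cong (_+ edgeSum UU) (edgeSum-+ NN NU (λ u v → NN u v + NU u v) λ _ _ → refl))
        (edgeSum-+ (λ u v → NN u v + NU u v) UU (λ _ _ → 1) λ u v → trans
          (solve 4 (λ x y x′ y′ → x :* y :+ (x :* y′ :+ x′ :* y) :+ x′ :* y′ := (x′ :+ x) :* (y′ :+ y))
            refl (N′ u) (N′ v) (U′ u) (U′ v))
          (cong₂ _*_ (U+N≡1 (toℕ u)) (U+N≡1 (toℕ v))))
        where open ℕ.+-*-Solver

-- Limits of rational sequences and the root of 2r².

module _ where
  open import Data.Rational.Base hiding (_≃_; NonZero; floor)
  open import Data.Integer.Base using (+_)

  private
    variable
      κ ℓ : Level
      E : Set κ

  infix 4 _~_

  -- The relation _≃_ on bare sequences, without the Cauchy proofs that ℝ carries.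
  record _~_ (x y : ℕ → ℚ) : Set where
    constructor mk~
    field
      close~ : ∀ ε → 0ℚ < ε → ∃[ N ] (∀ k → N ℕ.≤ k → ∣ x k - y k ∣ < ε)

  open _~_

  ~⇒≃ : ∀ {x y} → seq x ~ seq y → x ≃ y
  ~⇒≃ (mk~ x~y) = mk≃ x~y

  ≗⇒~ : ∀ {x y : ℕ → ℚ} → (∀ k → x k ≡ y k) → x ~ y
  ≗⇒~ {x} {y} x≗y = mk~ λ ε 0<ε → 0 , λ k _ →
    subst (_< ε) (sym (cong ∣_∣ (trans (cong (_- y k) (x≗y k)) (ℚ.+-inverseʳ (y k))))) 0<ε

  ~-trans : ∀ {x y z} → x ~ y → y ~ z → x ~ z
  ~-trans {x} {y} {z} x~y y~z = mk~ λ ε 0<ε →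
    let M , p = close~ x~y (½ * ε) (0<⇒0<½* 0<ε)
        N , q = close~ y~z (½ * ε) (0<⇒0<½* 0<ε)
    in M ℕ.⊔ N , λ k ≤k → begin-strict
      ∣ x k - z k ∣                      ≡⟨ cong ∣_∣ (telescope (x k) (y k) (z k)) ⟩
      ∣ (x k - y k) + (y k - z k) ∣      ≤⟨ ℚ.∣p+q∣≤∣p∣+∣q∣ (x k - y k) (y k - z k) ⟩
      ∣ x k - y k ∣ + ∣ y k - z k ∣      <⟨ ℚ.+-mono-< (p k (ℕ.m⊔n≤o⇒m≤o M N ≤k)) (q k (ℕ.m⊔n≤o⇒n≤o M N ≤k)) ⟩
      ½ * ε + ½ * ε                      ≡⟨ ½*+½* ε ⟩
      ε                                  ∎
    where
    open ℚ.≤-Reasoning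
    open ℚ.+-*-Solver
    telescope : ∀ a b c → a - c ≡ (a - b) + (b - c)
    telescope = solve 3 (λ a b c → a :- c := (a :- b) :+ (b :- c)) refl

  ~-+-cong : ∀ {x x′ y y′} → x ~ x′ → y ~ y′ → (λ k → x k + y k) ~ (λ k → x′ k + y′ k)
  ~-+-cong {x} {x′} {y} {y′} x~x′ y~y′ = mk~ λ ε 0<ε →
    let M , p = close~ x~x′ (½ * ε) (0<⇒0<½* 0<ε)
        N , q = close~ y~y′ (½ * ε) (0<⇒0<½* 0<ε)
    in M ℕ.⊔ N , λ k ≤k → begin-strict
      ∣ (x k + y k) - (x′ k + y′ k) ∣      ≡⟨ cong ∣_∣ (+-interchange-- (x k) (y k) (x′ k) (y′ k)) ⟩
      ∣ (x k - x′ k) + (y k - y′ k) ∣      ≤⟨ ℚ.∣p+q∣≤∣p∣+∣q∣ (x k - x′ k) (y k - y′ k) ⟩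
      ∣ x k - x′ k ∣ + ∣ y k - y′ k ∣      <⟨ ℚ.+-mono-< (p k (ℕ.m⊔n≤o⇒m≤o M N ≤k)) (q k (ℕ.m⊔n≤o⇒n≤o M N ≤k)) ⟩
      ½ * ε + ½ * ε                        ≡⟨ ½*+½* ε ⟩
      ε                                    ∎
    where open ℚ.≤-Reasoning

  ~-*-congˡ : ∀ c {x y} → x ~ y → (λ k → c * x k) ~ (λ k → c * y k)
  ~-*-congˡ c {x} {y} x~y = mk~ λ ε 0<ε →
    -- Both constants are positive even for c = 0, and their surplus 2δ over ∣c∣δ makes the final
    -- bound strict.
    let δ , 0<δ , eq = split-product 1ℚ (1ℚ + ∣ c ∣) ε (ℚ.positive⁻¹ 1ℚ) 0<1+∣c∣ 0<ε
        N , p = close~ x~y δ 0<δ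
    in N , λ k N≤k → begin-strict
      ∣ c * x k - c * y k ∣                 ≡⟨ cong ∣_∣ (factor c (x k) (y k)) ⟩
      ∣ c * (x k - y k) ∣                   ≡⟨ ℚ.∣p*q∣≡∣p∣*∣q∣ c (x k - y k) ⟩
      ∣ c ∣ * ∣ x k - y k ∣                 ≤⟨ ℚ.*-monoˡ-≤-nonNeg ∣ c ∣ {{ℚ.∣-∣-nonNeg c}} (ℚ.<⇒≤ (p k N≤k)) ⟩
      ∣ c ∣ * δ                             ≡⟨ sym (ℚ.+-identityˡ (∣ c ∣ * δ)) ⟩
      0ℚ + ∣ c ∣ * δ                        <⟨ ℚ.+-monoˡ-< (∣ c ∣ * δ) (ℚ.+-mono-< 0<δ 0<δ) ⟩
      (δ + δ) + ∣ c ∣ * δ                   ≡⟨ regroup δ ∣ c ∣ ⟩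
      1ℚ * δ + (1ℚ + ∣ c ∣) * δ             ≡⟨ eq ⟩
      ε                                     ∎
    where
    open ℚ.≤-Reasoning
    open ℚ.+-*-Solver
    0<1+∣c∣ : 0ℚ < 1ℚ + ∣ c ∣
    0<1+∣c∣ = ℚ.+-mono-<-≤ (ℚ.positive⁻¹ 1ℚ) (ℚ.0≤∣p∣ c)
    factor : ∀ c x y → c * x - c * y ≡ c * (x - y)
    factor = solve 3 (λ c x y → c :* x :- c :* y := c :* (x :- y)) refl
    regroup : ∀ δ c → (δ + δ) + c * δ ≡ 1ℚ * δ + (1ℚ + c) * δ
    regroup = solve 2 (λ δ c → (δ :+ δ) :+ c :* δ := con 1ℚ :* δ :+ (con 1ℚ :+ c) :* δ) refl

  square-cancel-≤ : ∀ {x y} → 0ℚ ≤ y → x * x ≤ y * y → x ≤ y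
  square-cancel-≤ {x} {y} 0≤y x²≤y² = ℚ.≮⇒≥ λ y<x → ℚ.<-irrefl {y * y} refl (begin-strict
    y * y   ≤⟨ ℚ.*-monoʳ-≤-nonNeg y {{nonNegative 0≤y}} (ℚ.<⇒≤ y<x) ⟩
    x * y   <⟨ ℚ.*-monoʳ-<-pos x {{positive (ℚ.≤-<-trans 0≤y y<x)}} y<x ⟩
    x * x   ≤⟨ x²≤y² ⟩
    y * y   ∎)
    where open ℚ.≤-Reasoning

  -- With s, t the approximations to √2 and √(2r²) at grid step d, s² ≤ 2 ≤ (s + d)² and t² ≤ 2r² ≤
  -- (t + d)². Comparing squares gives sr ≤ t + d and t ≤ (s + d)r, so t - sr lies between -d and
  -- rd, and (1 + r)d bounds it in both directions.
  √≈[r²+r²]~√≈2*r : ∀ r → 0ℚ ≤ r → √≈ (r * r + r * r) ~ (λ k → √≈ (+ 2 / 1) k * r)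
  √≈[r²+r²]~√≈2*r r 0≤r = mk~ λ ε 0<ε →
    let δ , 0<δ , eq = split-product 1ℚ (1ℚ + r) ε (ℚ.positive⁻¹ 1ℚ) 0<1+r 0<ε
        N , q = archimedean δ 0<δ
    in N , λ k N≤k → ∣∣<-intro
         (below ε δ 0<δ eq k (q k N≤k) (t-sr≤ k))
         (below ε δ 0<δ eq k (q k N≤k) (-[t-sr]≤ k))
    where
    open ℚ.≤-Reasoning
    open ℚ.+-*-Solver
    0<1+r : 0ℚ < 1ℚ + r
    0<1+r = ℚ.+-mono-<-≤ (ℚ.positive⁻¹ 1ℚ) 0≤r
    two : ℚ
    two = + 2 / 1
    s t d : ℕ → ℚ
    s k = √≈ two k
    t k = √≈ (r * r + r * r) k
    d k = + 1 / suc k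
    0≤d : ∀ k → 0ℚ ≤ d k
    0≤d k = 0≤/ 1 k
    0≤s : ∀ k → 0ℚ ≤ s k
    0≤s k = 0≤/ (√≈-numerator two k) k
    0≤t : ∀ k → 0ℚ ≤ t k
    0≤t k = 0≤/ (√≈-numerator (r * r + r * r) k) k
    0≤x*y : ∀ {x y} → 0ℚ ≤ x → 0ℚ ≤ y → 0ℚ ≤ x * y
    0≤x*y {x} {y} 0≤x 0≤y = ℚ.nonNegative⁻¹ (x * y)
      {{ℚ.nonNeg*nonNeg⇒nonNeg x {{nonNegative 0≤x}} y {{nonNegative 0≤y}}}}
    0≤r² : 0ℚ ≤ r * r
    0≤r² = 0≤x*y 0≤r 0≤r
    instance
      r²≥0 : NonNegative (r * r)
      r²≥0 = nonNegative 0≤r²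
      1+r>0 : Positive (1ℚ + r)
      1+r>0 = positive 0<1+r
    2r² : two * (r * r) ≡ r * r + r * r
    2r² = solve 1 (λ r → con two :* (r :* r) := r :* r :+ r :* r) refl r
    0⊔2r² : 0ℚ ⊔ (r * r + r * r) ≡ r * r + r * r
    0⊔2r² = ℚ.p≤q⇒p⊔q≡q (ℚ.+-mono-≤ 0≤r² 0≤r²)
    upper : ∀ a k → 0ℚ ⊔ a ≤ (√≈ a k + d k) * (√≈ a k + d k)
    upper a k = subst (λ u → 0ℚ ⊔ a ≤ u * u) (sym (/-suc (√≈-numerator a k) k)) (ℚ.<⇒≤ (√≈-upper a k))
    sr≤t+d : ∀ k → s k * r ≤ t k + d k
    sr≤t+d k = square-cancel-≤ (ℚ.+-mono-≤ (0≤t k) (0≤d k)) (begin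
      (s k * r) * (s k * r)          ≡⟨ sym (square-swap (s k) r) ⟩
      (s k * s k) * (r * r)          ≤⟨ ℚ.*-monoʳ-≤-nonNeg (r * r) (√≈-lower two k) ⟩
      two * (r * r)                  ≡⟨ 2r² ⟩
      r * r + r * r                  ≡⟨ sym 0⊔2r² ⟩
      0ℚ ⊔ (r * r + r * r)           ≤⟨ upper (r * r + r * r) k ⟩
      (t k + d k) * (t k + d k)      ∎)
    t≤[s+d]r : ∀ k → t k ≤ (s k + d k) * r
    t≤[s+d]r k = square-cancel-≤ (0≤x*y (ℚ.+-mono-≤ (0≤s k) (0≤d k)) 0≤r) (begin
      t k * t k                              ≤⟨ √≈-lower (r * r + r * r) k ⟩
      0ℚ ⊔ (r * r + r * r)                   ≡⟨ 0⊔2r² ⟩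
      r * r + r * r                          ≡⟨ sym 2r² ⟩
      two * (r * r)                          ≤⟨ ℚ.*-monoʳ-≤-nonNeg (r * r) (upper two k) ⟩
      (s k + d k) * (s k + d k) * (r * r)    ≡⟨ square-swap (s k + d k) r ⟩
      (s k + d k) * r * ((s k + d k) * r)    ∎)
    t-sr≤ : ∀ k → t k - s k * r ≤ (1ℚ + r) * d k
    t-sr≤ k = begin
      t k - s k * r                  ≤⟨ ℚ.+-monoˡ-≤ (- (s k * r)) (t≤[s+d]r k) ⟩
      (s k + d k) * r - s k * r      ≡⟨ solve 3 (λ s d r → (s :+ d) :* r :- s :* r := r :* d) refl (s k) (d k) r ⟩
      r * d k                        ≡⟨ sym (ℚ.+-identityˡ (r * d k)) ⟩
      0ℚ + r * d k                   ≤⟨ ℚ.+-monoˡ-≤ (r * d k) (0≤d k) ⟩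
      d k + r * d k                  ≡⟨ solve 2 (λ d r → d :+ r :* d := (con 1ℚ :+ r) :* d) refl (d k) r ⟩
      (1ℚ + r) * d k                 ∎
    -[t-sr]≤ : ∀ k → - (t k - s k * r) ≤ (1ℚ + r) * d k
    -[t-sr]≤ k = begin
      - (t k - s k * r)              ≡⟨ -‿-swap (t k) (s k * r) ⟩
      s k * r - t k                  ≤⟨ ℚ.+-monoˡ-≤ (- t k) (sr≤t+d k) ⟩
      t k + d k - t k                ≡⟨ solve 2 (λ t d → t :+ d :- t := d) refl (t k) (d k) ⟩
      d k                            ≡⟨ sym (ℚ.+-identityʳ (d k)) ⟩
      d k + 0ℚ                       ≤⟨ ℚ.+-monoʳ-≤ (d k) (0≤x*y 0≤r (0≤d k)) ⟩
      d k + r * d k                  ≡⟨ solve 2 (λ d r → d :+ r :* d := (con 1ℚ :+ r) :* d) refl (d k) r ⟩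
      (1ℚ + r) * d k                 ∎
    below : ∀ ε δ → 0ℚ < δ → 1ℚ * δ + (1ℚ + r) * δ ≡ ε → ∀ k → d k < δ →
            ∀ {x} → x ≤ (1ℚ + r) * d k → x < ε
    below ε δ 0<δ eq k d<δ {x} x≤ = begin-strict
      x                              ≤⟨ x≤ ⟩
      (1ℚ + r) * d k                 <⟨ ℚ.*-monoʳ-<-pos (1ℚ + r) d<δ ⟩
      (1ℚ + r) * δ                   ≡⟨ sym (ℚ.+-identityˡ _) ⟩
      0ℚ + (1ℚ + r) * δ              ≤⟨ ℚ.+-monoˡ-≤ ((1ℚ + r) * δ) (ℚ.<⇒≤ 0<δ) ⟩
      δ + (1ℚ + r) * δ               ≡⟨ cong (_+ (1ℚ + r) * δ) (sym (ℚ.*-identityˡ δ)) ⟩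
      1ℚ * δ + (1ℚ + r) * δ          ≡⟨ eq ⟩
      ε                              ∎

  -- The Sombor index as a combination of three edge weights.

  ν : ℕ → ℚ
  ν n = + n / 1

  ν-+ : ∀ m n → ν (m ℕ.+ n) ≡ ν m + ν n
  ν-+ m n = ℚ.toℚᵘ-injective
    (ℚᵘ.≃-trans (ℚ.toℚᵘ-fromℚᵘ (ℚᵘ.mkℚᵘ (+ (m ℕ.+ n)) 0))
    (ℚᵘ.≃-sym (ℚᵘ.≃-trans (ℚ.toℚᵘ-homo-+ (ν m) (ν n))
      (ℚᵘ.≃-trans (ℚᵘ.+-cong (ℚ.toℚᵘ-fromℚᵘ (ℚᵘ.mkℚᵘ (+ m) 0)) (ℚ.toℚᵘ-fromℚᵘ (ℚᵘ.mkℚᵘ (+ n) 0)))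
        (ℚᵘ.*≡* (cong₂ (λ x y → (x ℤ.+ y) ℤ.* + 1) (ℤ.*-identityʳ (+ m)) (ℤ.*-identityʳ (+ n))))))))

  -- Fixing the index `k` makes this an identity of rationals, proved by induction on the list. It
  -- is applied with `A`, `B`, `C` the three possible edge weights and `x`, `y`, `z` the indicators
  -- of the edge types.
  seq-sum-combination : ∀ (w : E → ℝ) (x y z : E → ℕ) A B C k →
    (∀ e → seq (w e) k ≡ ν (x e) * A + ν (y e) * B + ν (z e) * C) → ∀ es →
    seq (sumᴿ (map w es)) k ≡
    ν (List.sum (map x es)) * A + ν (List.sum (map y es)) * B + ν (List.sum (map z es)) * C
  seq-sum-combination w x y z A B C k eq [] =
    sym (cong₂ _+_ (cong₂ _+_ (ℚ.*-zeroˡ A) (ℚ.*-zeroˡ B)) (ℚ.*-zeroˡ C))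
  seq-sum-combination w x y z A B C k eq (e ∷ es) = begin
    seq (w e) k + seq (sumᴿ (map w es)) k
      ≡⟨ cong₂ _+_ (eq e) (seq-sum-combination w x y z A B C k eq es) ⟩
    (ν (x e) * A + ν (y e) * B + ν (z e) * C) + (ν xs * A + ν ys * B + ν zs * C)
      ≡⟨ solve 9 (λ a b c x y z x′ y′ z′ → (x :* a :+ y :* b :+ z :* c) :+ (x′ :* a :+ y′ :* b :+ z′ :* c)
                   := (x :+ x′) :* a :+ (y :+ y′) :* b :+ (z :+ z′) :* c) refl
           A B C (ν (x e)) (ν (y e)) (ν (z e)) (ν xs) (ν ys) (ν zs) ⟩
    (ν (x e) + ν xs) * A + (ν (y e) + ν ys) * B + (ν (z e) + ν zs) * C
      ≡⟨ cong₂ _+_ (cong₂ (λ s t → s * A + t * B) (ν-+ (x e) xs) (ν-+ (y e) ys)) (cong (_* C) (ν-+ (z e) zs)) ⟨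
    ν (x e ℕ.+ xs) * A + ν (y e ℕ.+ ys) * B + ν (z e ℕ.+ zs) * C ∎
    where
    open ≡-Reasoning
    open ℚ.+-*-Solver
    xs = List.sum (map x es)
    ys = List.sum (map y es)
    zs = List.sum (map z es)

  -- With F for φ(pq), the indices are the degree of a vertex and its values of N and U.
  data VertexType (F : ℚ) : ℚ → ℕ → ℕ → Set where
    nonunit : VertexType F F 1 0
    unit    : VertexType F (F - ν 1) 0 1

  edge-weight : ∀ {F x y m n m′ n′} k → VertexType F x m n → VertexType F y m′ n′ →
    √≈ (x * x + y * y) k ≡
    ν (m ℕ.* m′) * √≈ (F * F + F * F) k +
    ν (m ℕ.* n′ ℕ.+ n ℕ.* m′) * √≈ (F * F + (F - ν 1) * (F - ν 1)) k +
    ν (n ℕ.* n′) * √≈ ((F - ν 1) * (F - ν 1) + (F - ν 1) * (F - ν 1)) k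
  edge-weight {F} k S T = cases S T
    where
    open ℚ.+-*-Solver
    G = F - ν 1
    A = √≈ (F * F + F * F) k
    B = √≈ (F * F + G * G) k
    C = √≈ (G * G + G * G) k
    first : ∀ A B C → A ≡ 1ℚ * A + 0ℚ * B + 0ℚ * C
    first = solve 3 (λ A B C → A := con 1ℚ :* A :+ con 0ℚ :* B :+ con 0ℚ :* C) refl
    second : ∀ A B C → B ≡ 0ℚ * A + 1ℚ * B + 0ℚ * C
    second = solve 3 (λ A B C → B := con 0ℚ :* A :+ con 1ℚ :* B :+ con 0ℚ :* C) refl
    third : ∀ A B C → C ≡ 0ℚ * A + 0ℚ * B + 1ℚ * C
    third = solve 3 (λ A B C → C := con 0ℚ :* A :+ con 0ℚ :* B :+ con 1ℚ :* C) refl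
    cases : ∀ {x y m n m′ n′} → VertexType F x m n → VertexType F y m′ n′ →
      √≈ (x * x + y * y) k ≡ ν (m ℕ.* m′) * A + ν (m ℕ.* n′ ℕ.+ n ℕ.* m′) * B + ν (n ℕ.* n′) * C
    cases nonunit nonunit = first A B C
    cases nonunit unit    = second A B C
    -- When the unit endpoint comes first, the two squares under the root are in the opposite order.
    cases unit    nonunit = trans (cong (λ t → √≈ t k) (ℚ.+-comm (G * G) (F * F))) (second A B C)
    cases unit    unit    = third A B C

  -- Only the outer two weights are of the form √(2r²), with r = F and r = F - 1; the sign
  -- conditions serve to extract these r. The middle root is carried over unchanged.
  combination : ∀ {F c₀ c₁ c₂ d₀ d₁ d₂ x} → 0ℚ ≤ F → 0ℚ ≤ F - ν 1 → c₀ ≡ d₀ → c₁ ≡ d₁ → c₂ ≡ d₂ →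
    (∀ k → x k ≡ c₀ * √≈ (F * F + F * F) k + c₁ * √≈ (F * F + (F - ν 1) * (F - ν 1)) k +
                 c₂ * √≈ ((F - ν 1) * (F - ν 1) + (F - ν 1) * (F - ν 1)) k) →
    x ~ (λ k → √≈ (ν 2) k * d₀ * F + d₁ * √≈ (F * F + (F - ν 1) * (F - ν 1)) k + √≈ (ν 2) k * d₂ * (F - ν 1))
  combination {F} {c₀} {c₁} {c₂} 0≤F 0≤F-1 refl refl refl x≗ = ~-trans (≗⇒~ x≗) (~-trans
      (~-+-cong (~-+-cong (~-*-congˡ c₀ (√≈[r²+r²]~√≈2*r F 0≤F)) (≗⇒~ {λ k → c₁ * w₁ k} λ k → refl))
                (~-*-congˡ c₂ (√≈[r²+r²]~√≈2*r (F - ν 1) 0≤F-1)))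
      (≗⇒~ λ k → cong₂ _+_ (cong (_+ c₁ * w₁ k) (rotate c₀ (√≈ (ν 2) k) F)) (rotate c₂ (√≈ (ν 2) k) (F - ν 1))))
    where
    open ℚ.+-*-Solver
    w₁ : ℕ → ℚ
    w₁ = √≈ (F * F + (F - ν 1) * (F - ν 1))
    rotate : ∀ x y z → x * (y * z) ≡ y * x * z
    rotate = solve 3 (λ x y z → x :* (y :* z) := y :* x :* z) refl

  -- The arithmetic of reals is termwise, so the two expressions agree by computation once the terms
  -- of `P`, `Q`, `Φ` are identified with `p`, `q`, `f`. Keeping these as variables confines that
  -- computation to the real operations.
  ~⇒closed-form : ∀ (S P Q Φ : ℝ) {p q f : ℚ} →
      (∀ k → seq P k ≡ p) → (∀ k → seq Q k ≡ q) → (∀ k → seq Φ k ≡ f) →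
      let 𝟙 = fromℕ 1
          √2 = √ (fromℕ 2)
          α = (P -ᴿ 𝟙) *ᴿ (Q -ᴿ 𝟙)
          β = (P -ᴿ 𝟙) *ᴿ (Q -ᴿ 𝟙) *ᴿ (P +ᴿ Q -ᴿ fromℕ 3)
          ∣E∣ = fromℚ ½ *ᴿ ((P *ᴿ Q -ᴿ 𝟙) *ᴿ Φ)
          a = (p - ν 1) * (q - ν 1)
          b = (p - ν 1) * (q - ν 1) * (p + q - ν 3)
          e = ½ * ((p * q - ν 1) * f)
      in seq S ~ (λ k →
           √≈ (ν 2) k * a * f + b * √≈ (f * f + (f - ν 1) * (f - ν 1)) k + √≈ (ν 2) k * (e - a - b) * (f - ν 1)) →
         S
         ≃ √2 *ᴿ α *ᴿ Φ
           +ᴿ β *ᴿ √ (Φ ²ᴿ +ᴿ (Φ -ᴿ 𝟙) ²ᴿ)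
           +ᴿ √2 *ᴿ (∣E∣ -ᴿ α -ᴿ β) *ᴿ (Φ -ᴿ 𝟙)
  ~⇒closed-form S P Q Φ P≗p Q≗q Φ≗f S~ = ~⇒≃ (~-trans S~ (≗⇒~ λ k → evaluate k (P≗p k) (Q≗q k) (Φ≗f k)))
    where
    evaluate : ∀ k {p q f} → seq P k ≡ p → seq Q k ≡ q → seq Φ k ≡ f →
      let 𝟙 = fromℕ 1
          √2 = √ (fromℕ 2)
          α = (P -ᴿ 𝟙) *ᴿ (Q -ᴿ 𝟙)
          β = (P -ᴿ 𝟙) *ᴿ (Q -ᴿ 𝟙) *ᴿ (P +ᴿ Q -ᴿ fromℕ 3)
          ∣E∣ = fromℚ ½ *ᴿ ((P *ᴿ Q -ᴿ 𝟙) *ᴿ Φ)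
          a = (p - ν 1) * (q - ν 1)
          b = (p - ν 1) * (q - ν 1) * (p + q - ν 3)
          e = ½ * ((p * q - ν 1) * f)
       in √≈ (ν 2) k * a * f + b * √≈ (f * f + (f - ν 1) * (f - ν 1)) k + √≈ (ν 2) k * (e - a - b) * (f - ν 1) ≡
         seq (√2 *ᴿ α *ᴿ Φ
           +ᴿ β *ᴿ √ (Φ ²ᴿ +ᴿ (Φ -ᴿ 𝟙) ²ᴿ)
           +ᴿ √2 *ᴿ (∣E∣ -ᴿ α -ᴿ β) *ᴿ (Φ -ᴿ 𝟙)) k
    evaluate k refl refl refl = refl

  ν-pred : ∀ {m n} → m ℕ.+ 1 ≡ n → ν m ≡ ν n - ν 1
  ν-pred {m} {n} m+1≡n = begin
    ν m                   ≡⟨ solve 2 (λ x y → x := x :+ y :- y) refl (ν m) (ν 1) ⟩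
    ν m + ν 1 - ν 1       ≡⟨ cong (_- ν 1) (trans (sym (ν-+ m 1)) (cong ν m+1≡n)) ⟩
    ν n - ν 1             ∎
    where
    open ≡-Reasoning
    open ℚ.+-*-Solver

  ν-pred′ : ∀ n .{{_ : ℕ.NonZero n}} → ν (ℕ.pred n) ≡ ν n - ν 1
  ν-pred′ n = ν-pred (trans (ℕ.+-comm (ℕ.pred n) 1) (ℕ.suc-pred n))

  -- From edge counts in ℕ to the coefficients of the closed form.

  module SomborIndex (p q : ℕ)
    (p-prime : Prime p) (q-prime : Prime q) (p-odd : ¬ (2 ∣ p)) (q-odd : ¬ (2 ∣ q)) (p≢q : p ≢ q)
    (G : SimpleGraph (Fin (p ℕ.* q)) ℓ) (adj? : Decidable₂ (Adj G))
    (adjacency : ∀ u v → ind (adj? u v) ℕ.+ ind (u Fin.≟ v) ℕ.* Units.U p q (toℕ v) ≡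
                         Units.U p q (toℕ u ℕ.+ toℕ v))
    (P Q F : ℚ) (νp≡P : ν p ≡ P) (νq≡Q : ν q ≡ Q) (νφ≡F : ν (φ (p ℕ.* q)) ≡ F)
    where

    open OddPrimes p q p-prime q-prime p-odd q-odd p≢q
    open UnitSumGraph G adj? adjacency
    open ≡-Reasoning
    open ℚ.+-*-Solver

    vertex-type : ∀ u → VertexType F (ν (degree G adj? u)) (N′ u) (U′ u)
    vertex-type u = by-unit (unit? (toℕ u)) (trans (degree-U u) (sym φ≡))
      where
      -- Abstracting the decision lets one case split reduce both indicators and the degree equation
      -- together.
      by-unit : (u? : Dec (Unit (toℕ u))) → degree G adj? u ℕ.+ ind u? ≡ φ (p ℕ.* q) →
                VertexType F (ν (degree G adj? u)) (ind (¬? u?)) (ind u?)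
      by-unit (yes _) d+1≡φ = subst (λ x → VertexType F x 0 1)
        (sym (trans (ν-pred d+1≡φ) (cong (_- ν 1) νφ≡F))) unit
      by-unit (no _)  d+0≡φ = subst (λ x → VertexType F x 1 0)
        (trans (sym νφ≡F) (cong ν (trans (sym d+0≡φ) (ℕ.+-identityʳ _)))) nonunit

    somborIndex-by-type : ∀ k → seq (somborIndex G adj?) k ≡
      ν (edgeSum NN) * √≈ (F * F + F * F) k +
      ν (edgeSum NU) * √≈ (F * F + (F - ν 1) * (F - ν 1)) k +
      ν (edgeSum UU) * √≈ ((F - ν 1) * (F - ν 1) + (F - ν 1) * (F - ν 1)) k
    somborIndex-by-type k = seq-sum-combination _
      (uncurry NN) (uncurry NU) (uncurry UU) _ _ _ k
      (λ (u , v) → edge-weight k (vertex-type u) (vertex-type v)) (edges G adj?)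

    α β ∣E∣ : ℚ
    α = (P - ν 1) * (Q - ν 1)
    β = (P - ν 1) * (Q - ν 1) * (P + Q - ν 3)
    ∣E∣ = ½ * ((P * Q - ν 1) * F)

    νq′ : ν q′ ≡ Q - ν 1
    νq′ = trans (ν-pred′ q) (cong (_- ν 1) νq≡Q)

    νp′q′ : ν (p′ ℕ.* q′) ≡ α
    νp′q′ = trans (ι-* p′ q′) (cong₂ _*_ (trans (ν-pred′ p) (cong (_- ν 1) νp≡P)) νq′)

    ν-edgeSum-NN : ν (edgeSum NN) ≡ α
    ν-edgeSum-NN = trans (cong ν edgeSum-NN) νp′q′

    ν-edgeSum-NU : ν (edgeSum NU) ≡ β
    ν-edgeSum-NU = begin
      ν c                              ≡⟨ solve 2 (λ x y → x := x :+ y :- y) refl (ν c) (ν 2 * α) ⟩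
      ν c + ν 2 * α - ν 2 * α          ≡⟨ cong (_- ν 2 * α) (begin
        ν c + ν 2 * α                    ≡⟨ cong (λ t → ν c + ν 2 * t) νp′q′ ⟨
        ν c + ν 2 * ν (p′ ℕ.* q′)        ≡⟨ cong (λ t → ν c + t) (ι-* 2 (p′ ℕ.* q′)) ⟨
        ν c + ν (2 ℕ.* (p′ ℕ.* q′))      ≡⟨ ν-+ c (2 ℕ.* (p′ ℕ.* q′)) ⟨
        ν (c ℕ.+ 2 ℕ.* (p′ ℕ.* q′))      ≡⟨ cong ν edgeSum-NU ⟩
        ν ((q′ ℕ.+ p) ℕ.* (p′ ℕ.* q′))   ≡⟨ ι-* (q′ ℕ.+ p) (p′ ℕ.* q′) ⟩
        ν (q′ ℕ.+ p) * ν (p′ ℕ.* q′)     ≡⟨ cong₂ _*_ (trans (ν-+ q′ p) (cong₂ _+_ νq′ νp≡P)) νp′q′ ⟩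
        (Q - ν 1 + P) * α                ∎) ⟩
      (Q - ν 1 + P) * α - ν 2 * α      ≡⟨ expand P Q ⟩
      β                                ∎
      where
      c = edgeSum NU
      expand : ∀ x y → (y - ν 1 + x) * ((x - ν 1) * (y - ν 1)) - ν 2 * ((x - ν 1) * (y - ν 1)) ≡
                       (x - ν 1) * (y - ν 1) * (x + y - ν 3)
      expand = solve 2 (λ x y →
        (y :- con (ν 1) :+ x) :* ((x :- con (ν 1)) :* (y :- con (ν 1))) :-
          con (ν 2) :* ((x :- con (ν 1)) :* (y :- con (ν 1))) :=
        (x :- con (ν 1)) :* (y :- con (ν 1)) :* (x :+ y :- con (ν 3))) refl

    -- The identity in ℕ determines 2∣E∣ + φ(pq); the subtraction and the halving take place here.
    ν-edgeSum-1 : ν (edgeSum (λ _ _ → 1)) ≡ ∣E∣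
    ν-edgeSum-1 = begin
      ν m                              ≡⟨ solve 2 (λ x y → x := con ½ :* (con (ν 2) :* x :+ y :- y)) refl (ν m) F ⟩
      ½ * (ν 2 * ν m + F - F)          ≡⟨ cong (λ t → ½ * (t - F)) (begin
        ν 2 * ν m + F                    ≡⟨ cong₂ _+_ (sym (ι-* 2 m)) F≡ ⟩
        ν (2 ℕ.* m) + ν (p′ ℕ.* q′)      ≡⟨ ν-+ (2 ℕ.* m) (p′ ℕ.* q′) ⟨
        ν (2 ℕ.* m ℕ.+ p′ ℕ.* q′)        ≡⟨ cong ν edgeSum-1 ⟩
        ν (p ℕ.* q ℕ.* (p′ ℕ.* q′))      ≡⟨ ι-* (p ℕ.* q) (p′ ℕ.* q′) ⟩
        ν (p ℕ.* q) * ν (p′ ℕ.* q′)      ≡⟨ cong₂ _*_ (trans (ι-* p q) (cong₂ _*_ νp≡P νq≡Q)) (sym F≡) ⟩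
        P * Q * F                        ∎) ⟩
      ½ * (P * Q * F - F)              ≡⟨ solve 2 (λ x y → con ½ :* (x :* y :- y) := con ½ :* ((x :- con (ν 1)) :* y))
                                            refl (P * Q) F ⟩
      ∣E∣                              ∎
      where
      m = edgeSum (λ _ _ → 1)
      F≡ : F ≡ ν (p′ ℕ.* q′)
      F≡ = trans (sym νφ≡F) (cong ν φ≡)

    ν-edgeSum-UU : ν (edgeSum UU) ≡ ∣E∣ - α - β
    ν-edgeSum-UU = begin
      ν z                             ≡⟨ solve 3 (λ x y z → z := x :+ y :+ z :- x :- y) refl (ν x) (ν y) (ν z) ⟩
      ν x + ν y + ν z - ν x - ν y     ≡⟨ cong (λ t → t - ν x - ν y) (begin
        ν x + ν y + ν z                 ≡⟨ cong (_+ ν z) (ν-+ x y) ⟨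
        ν (x ℕ.+ y) + ν z               ≡⟨ ν-+ (x ℕ.+ y) z ⟨
        ν (x ℕ.+ y ℕ.+ z)               ≡⟨ cong ν edgeSum-NN+NU+UU ⟩
        ν (edgeSum (λ _ _ → 1))         ≡⟨ ν-edgeSum-1 ⟩
        ∣E∣                             ∎) ⟩
      ∣E∣ - ν x - ν y                 ≡⟨ cong₂ (λ s t → ∣E∣ - s - t) ν-edgeSum-NN ν-edgeSum-NU ⟩
      ∣E∣ - α - β                     ∎
      where
      x = edgeSum NN
      y = edgeSum NU
      z = edgeSum UU

    0≤F : 0ℚ ≤ F
    0≤F = subst (0ℚ ≤_) νφ≡F (0≤/ (φ (p ℕ.* q)) 0)

    0≤F-1 : 0ℚ ≤ F - ν 1
    0≤F-1 = subst (0ℚ ≤_) (trans (ν-pred′ (φ (p ℕ.* q)) {{φ≢0}}) (cong (_- ν 1) νφ≡F))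
      (0≤/ (ℕ.pred (φ (p ℕ.* q))) 0)
      where
      pred≢0 : ∀ {r} → Prime r → ℕ.NonZero (ℕ.pred r)
      pred≢0 r-prime = ℕ.>-nonZero (ℕ.pred-mono-≤ (ℕ.nonTrivial⇒n>1 _ {{prime⇒nonTrivial r-prime}}))
      -- `pred` is a true subtraction of 1 only away from 0; here (p - 1)(q - 1) is nonzero because
      -- primes exceed 1.
      φ≢0 : ℕ.NonZero (φ (p ℕ.* q))
      φ≢0 = subst ℕ.NonZero (sym φ≡) (ℕ.m*n≢0 p′ q′ {{pred≢0 p-prime}} {{pred≢0 q-prime}})

    somborIndex~ : seq (somborIndex G adj?) ~ (λ k →
      √≈ (ν 2) k * α * F + β * √≈ (F * F + (F - ν 1) * (F - ν 1)) k + √≈ (ν 2) k * (∣E∣ - α - β) * (F - ν 1))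
    somborIndex~ = combination 0≤F 0≤F-1 ν-edgeSum-NN ν-edgeSum-NU ν-edgeSum-UU somborIndex-by-type

open import Data.Nat.Base using (ℕ; _*_; _<_)

theorem4p2 :
  ∀ (p q : ℕ) (p-prime : Prime p) (q-prime : Prime q) →
  ¬ (2 ∣ p) → ¬ (2 ∣ q) → p < q →
  let nz = primes⇒nonZero p-prime q-prime
      G = unitGraph (ℤ/ (p * q) {{nz}})
      P = fromℕ p
      Q = fromℕ q
      Φ = fromℕ (φ (p * q))
      𝟙 = fromℕ 1
      √2 = √ (fromℕ 2)
      α = (P -ᴿ 𝟙) *ᴿ (Q -ᴿ 𝟙)
      β = (P -ᴿ 𝟙) *ᴿ (Q -ᴿ 𝟙) *ᴿ (P +ᴿ Q -ᴿ fromℕ 3)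
      ∣E∣ = fromℚ ½ *ᴿ ((P *ᴿ Q -ᴿ 𝟙) *ᴿ Φ)
  in somborIndex G (ℤ/-unitGraph-adj? (p * q) {{nz}})
     ≃ √2 *ᴿ α *ᴿ Φ
       +ᴿ β *ᴿ √ (Φ ²ᴿ +ᴿ (Φ -ᴿ 𝟙) ²ᴿ)
       +ᴿ √2 *ᴿ (∣E∣ -ᴿ α -ᴿ β) *ᴿ (Φ -ᴿ 𝟙)
theorem4p2 p q p-prime q-prime p-odd q-odd p<q =
  let nz = primes⇒nonZero p-prime q-prime
      G = unitGraph (ℤ/ (p * q) {{nz}})
      adj? = ℤ/-unitGraph-adj? (p * q) {{nz}}
      p≢q = ℕ.<⇒≢ p<q
  in ~⇒closed-form (somborIndex G adj?) (fromℕ p) (fromℕ q) (fromℕ (φ (p * q)))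
       {ν p} {ν q} {ν (φ (p * q))} (λ _ → refl) (λ _ → refl) (λ _ → refl)
       (SomborIndex.somborIndex~ p q p-prime q-prime p-odd q-odd p≢q G adj?
         (OddPrimes.unitGraph-adjacency p q p-prime q-prime p-odd q-odd p≢q)
         (ν p) (ν q) (ν (φ (p * q))) refl refl refl)
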